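{- For all integers $k\ge 1$ and $0\le i\le k-1$, $$|\mathrm{RedVHC}_k(\mathrm{Av}_{3k-i}(312))|=\underline{\mathrm{Duck}}_{k,i}=\sum_{j=i}^{k-1}\binom{j}{i}\,\mathrm{Duck}_{k,j}.$$
   Context: $S_n$ is the set of permutations $\pi=\pi_1\cdots\pi_n$ of $\{1,\dots,n\}$. $\pi$ is $312$-avoiding if there are no indices $a<b<c$ with $\pi_b<\pi_c<\pi_a$; $\mathrm{Av}_n(312)\subseteq S_n$ is the set of $312$-avoiding permutations of length $n$. The plot of $\pi$ is the set of points $(i,\pi_i)$, $1\le i\le n$. If $\pi_i>\pi_{i+1}$, then $i$ is a descent, $(i,\pi_i)$ is a descent top and $(i+1,\pi_{i+1})$ is a descent bottom. A hook on $\pi$ from $(i,\pi_i)$ to $(j,\pi_j)$, where $i<j$ and $\pi_i<\pi_j$, consists of the vertical segment from $(i,\pi_i)$ up to $(i,\pi_j)$ followed by the horizontal segment from $(i,\pi_j)$ to $(j,\pi_j)$. The point $(i,\pi_i)$ is its southwest (SW) endpoint and $(j,\pi_j)$ its northeast (NE) endpoint. A valid hook configuration on $\pi$ is a set of hooks on $\pi$ such that: (i) the set of SW endpoints of the hooks is exactly the set of descent tops of $\pi$; (ii) no point of the plot lies directly above a hook (for a hook from $(i,\pi_i)$ to $(j,\pi_j)$ there is no $l$ with $i<l<j$ and $\pi_l>\pi_j$); (iii) distinct hooks do not intersect, except at endpoints (the NE endpoint of one hook may be the SW endpoint of another; two hooks sharing the same NE endpoint, or the same SW endpoint, overlap in a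 segment and are not allowed). It is reduced if every point of the plot is a hook endpoint or a descent bottom (or both). For a set $S$ of permutations, $\mathrm{RedVHC}_k(S)$ is the set of all reduced valid hook configurations with exactly $k$ hooks on permutations in $S$ (a configuration includes the data of its underlying permutation). A 3D-Dyck word of length $3k$ is a word with $k$ letters X, $k$ letters Y and $k$ letters Z such that in every prefix the number of X's is at least the number of Y's, which is at least the number of Z's. $\mathrm{Duck}_{k,j}$ is the number of 3D-Dyck words of length $3k$ in which exactly $j$ of the Y's do not have an X immediately before them. An underlined duck word of length $3k$ is a 3D-Dyck word of length $3k$ in which some (possibly zero) of the Y's are underlined, such that no underlined Y has an X immediately before it; $\underline{\mathrm{Duck}}_{k,i}$ is the number of underlined duck words of length $3k$ with exactly $i$ underlined Y's. -}

module Defs where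

open import Level using (0ℓ)
open import Data.Bool.Base using (Bool; true; false)
open import Data.Fin.Base using (Fin; toℕ) renaming (_<_ to _<ᶠ_; _≤_ to _≤ᶠ_)
open import Data.Fin.Properties as Fin using (all?; any?)
open import Data.Fin.Subset using (Subset; _∈_; ∣_∣)
open import Data.Fin.Subset.Properties using (_∈?_)
open import Data.List.Base as List using (List; []; _∷_; length; filter; allFin; inits; cartesianProduct; cartesianProductWith; applyUpTo)
import Data.List.Membership.Propositional as Mem
open import Data.List.Membership.Propositional.Properties using (∈-allFin; ∈-cartesianProduct⁺; ∈-cartesianProductWith⁺)
open import Data.List.Relation.Unary.All as All using (All; []; _∷_)
open import Data.List.Relation.Unary.AllPairs using ([]; _∷_)
open import Data.List.Relation.Unary.Any using (here; there)
open import Data.List.Relation.Unary.Unique.Propositional using (Unique)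
open import Data.List.Relation.Unary.Unique.Propositional.Properties using (allFin⁺; cartesianProduct⁺; cartesianProductWith⁺)
open import Data.Nat.Base using (ℕ; zero; suc; _+_; _*_; _∸_; _≤_)
import Data.Nat.ListAction as ℕ
import Data.Nat.Properties as ℕ
open import Data.Product.Base using (_×_; _,_; ∃-syntax; uncurry)
open import Data.Product.Properties using (≡-dec)
open import Data.Sum.Base using (_⊎_)
open import Data.Vec.Base as Vec using (Vec; []; _∷_; lookup; toList)
import Data.Vec.Properties as Vec
open import Function.Base using (_∘_)
open import Function.Bundles using (_⇔_; mk⇔; Equivalence)
open import Function.Definitions using (Injective)
open import Relation.Binary.Definitions using (DecidableEquality)
open import Relation.Binary.PropositionalEquality using (_≡_; _≢_; refl)
open import Relation.Nullary.Decidable using (Dec; yes; no; ¬?; map′; _×-dec_; _⊎-dec_; _→-dec_)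
open import Relation.Nullary.Negation using (¬_)
open import Relation.Unary using (Pred; Decidable)

------------------------------------------------------------------------
-- Cardinalities of decidable subsets of a finite type

record Listing (A : Set) : Set where
  field
    elements : List A
    unique   : Unique elements
    complete : ∀ a → a Mem.∈ elements

open Listing

card : {A : Set} → Listing A → {P : Pred A 0ℓ} → Decidable P → ℕ
card L P? = length (filter P? (elements L))

fins : ∀ n → Listing (Fin n)
fins n = record { elements = allFin n ; unique = allFin⁺ n ; complete = ∈-allFin }

bools : Listing Bool
bools = record
  { elements = false ∷ true ∷ []
  ; unique   = ((λ ()) ∷ []) ∷ [] ∷ []
  ; complete = λ { false → here refl ; true → there (here refl) }
  }

infixr 2 _⊗_
_⊗_ : {A B : Set} → Listing A → Listing B → Listing (A × B)
L ⊗ M = record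
  { elements = cartesianProduct (elements L) (elements M)
  ; unique   = cartesianProduct⁺ (unique L) (unique M)
  ; complete = λ (a , b) → ∈-cartesianProduct⁺ (complete L a) (complete M b)
  }

vecs : {A : Set} → Listing A → ∀ n → Listing (Vec A n)
vecs L zero = record
  { elements = [] ∷ []
  ; unique   = [] ∷ []
  ; complete = λ { [] → here refl }
  }
vecs L (suc n) = record
  { elements = cartesianProductWith _∷_ (elements L) (elements (vecs L n))
  ; unique   = cartesianProductWith⁺ _∷_ Vec.∷-injective (unique L) (unique (vecs L n))
  ; complete = λ { (a ∷ v) → ∈-cartesianProductWith⁺ _∷_ (complete L a) (complete (vecs L n) v) }
  }

subsets : ∀ n → Listing (Subset n)
subsets = vecs bools

infix 4 _⋖_ _⋖?_
_⋖_ : ∀ {n} → Fin n → Fin n → Set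
i ⋖ j = toℕ j ≡ suc (toℕ i)

_⋖?_ : ∀ {n} (i j : Fin n) → Dec (i ⋖ j)
i ⋖? j = toℕ j ℕ.≟ suc (toℕ i)

------------------------------------------------------------------------
-- Permutations in one-line notation

-- Positions and values are numbered from 0 rather than from 1, and
-- permutations are vectors because function-based ones do not have
-- decidable propositional equality.

OneLine : ℕ → Set
OneLine n = Vec (Fin n) n

module _ {n : ℕ} where

  IsPermutation : Pred (OneLine n) 0ℓ
  IsPermutation π = Injective _≡_ _≡_ (lookup π)

  Avoids312 : Pred (OneLine n) 0ℓ
  Avoids312 π = ∀ a b c → a <ᶠ b → b <ᶠ c →
    ¬ (lookup π b <ᶠ lookup π c × lookup π c <ᶠ lookup π a)

  Av312 : Pred (OneLine n) 0ℓ
  Av312 π = IsPermutation π × Avoids312 π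

  DescentTop : OneLine n → Pred (Fin n) 0ℓ
  DescentTop π i = ∃[ j ] i ⋖ j × lookup π j <ᶠ lookup π i

  DescentBottom : OneLine n → Pred (Fin n) 0ℓ
  DescentBottom π j = ∃[ i ] i ⋖ j × lookup π j <ᶠ lookup π i

  isPermutation? : Decidable IsPermutation
  isPermutation? π = map′ (λ f {i} {j} → f i j) (λ f i j → f {i} {j})
    (all? λ i → all? λ j → (lookup π i Fin.≟ lookup π j) →-dec (i Fin.≟ j))

  av312? : Decidable Av312
  av312? π = isPermutation? π ×-dec
    all? λ a → all? λ b → all? λ c →
      (a Fin.<? b) →-dec ((b Fin.<? c) →-dec
      ¬? ((lookup π b Fin.<? lookup π c) ×-dec (lookup π c Fin.<? lookup π a)))

  descentTop? : ∀ π → Decidable (DescentTop π)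
  descentTop? π i = any? λ j → (i ⋖? j) ×-dec (lookup π j Fin.<? lookup π i)

  descentBottom? : ∀ π → Decidable (DescentBottom π)
  descentBottom? π j = any? λ i → (i ⋖? j) ×-dec (lookup π j Fin.<? lookup π i)

------------------------------------------------------------------------
-- Valid hook configurations

-- The pair (i , j) stands for the hook from (i , π i) to (j , π j).
Hook : ℕ → Set
Hook n = Fin n × Fin n

-- A set of hooks is stored row by row: row i holds the j for which the
-- hook (i , j) is present.
HookSet : ℕ → Set
HookSet n = Vec (Subset n) n

Point : ℕ → Set
Point n = Fin n × Fin n

infix 4 _∈ʰ_
_∈ʰ_ : ∀ {n} → Hook n → HookSet n → Set
(i , j) ∈ʰ H = j ∈ lookup H i

hookCount : ∀ {n} → HookSet n → ℕ
hookCount H = Vec.sum (Vec.map ∣_∣ H)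

module _ {n : ℕ} (π : OneLine n) where

  IsHook : Pred (Hook n) 0ℓ
  IsHook (i , j) = i <ᶠ j × lookup π i <ᶠ lookup π j

  OnHook : Hook n → Pred (Point n) 0ℓ
  OnHook (i , j) (x , y) =
      (x ≡ i × lookup π i ≤ᶠ y × y ≤ᶠ lookup π j)
    ⊎ (y ≡ lookup π j × i ≤ᶠ x × x ≤ᶠ j)

  IsEndpoint : Hook n → Pred (Point n) 0ℓ
  IsEndpoint (i , j) p = p ≡ (i , lookup π i) ⊎ p ≡ (j , lookup π j)

  -- Only lattice points are compared.  This loses nothing: hooks consist of
  -- axis-parallel segments with lattice endpoints, so two of them crossing
  -- or touching do so at a lattice point, and two distinct ones overlapping
  -- in a segment share an SW endpoint or an NE endpoint, whence the corner of
  -- one of them is a common lattice point and is not an endpoint.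
  MeetOnlyAtEndpoints : Hook n → Hook n → Set
  MeetOnlyAtEndpoints h h′ = ∀ x y → OnHook h (x , y) → OnHook h′ (x , y) →
    IsEndpoint h (x , y) × IsEndpoint h′ (x , y)

  record IsVHC (H : HookSet n) : Set where
    field
      hooks       : ∀ i j → (i , j) ∈ʰ H → IsHook (i , j)
      sw⇔top      : ∀ i → (∃[ j ] (i , j) ∈ʰ H) ⇔ DescentTop π i
      nothingOver : ∀ i j → (i , j) ∈ʰ H →
                    ¬ (∃[ l ] i <ᶠ l × l <ᶠ j × lookup π j <ᶠ lookup π l)
      noCrossing  : ∀ i j i′ j′ → (i , j) ∈ʰ H → (i′ , j′) ∈ʰ H →
                    (i , j) ≢ (i′ , j′) → MeetOnlyAtEndpoints (i , j) (i′ , j′)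

  IsReduced : Pred (HookSet n) 0ℓ
  IsReduced H = ∀ p →
    (∃[ j ] (p , j) ∈ʰ H) ⊎ (∃[ i ] (i , p) ∈ʰ H) ⊎ DescentBottom π p

  isHook? : Decidable IsHook
  isHook? (i , j) = (i Fin.<? j) ×-dec (lookup π i Fin.<? lookup π j)

  onHook? : ∀ h → Decidable (OnHook h)
  onHook? (i , j) (x , y) =
      ((x Fin.≟ i) ×-dec (lookup π i Fin.≤? y) ×-dec (y Fin.≤? lookup π j))
    ⊎-dec ((y Fin.≟ lookup π j) ×-dec (i Fin.≤? x) ×-dec (x Fin.≤? j))

  isEndpoint? : ∀ h → Decidable (IsEndpoint h)
  isEndpoint? (i , j) p =
    ≡-dec Fin._≟_ Fin._≟_ p (i , lookup π i) ⊎-dec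
    ≡-dec Fin._≟_ Fin._≟_ p (j , lookup π j)

  meetOnlyAtEndpoints? : ∀ h h′ → Dec (MeetOnlyAtEndpoints h h′)
  meetOnlyAtEndpoints? h h′ = all? λ x → all? λ y →
    onHook? h (x , y) →-dec (onHook? h′ (x , y) →-dec
    (isEndpoint? h (x , y) ×-dec isEndpoint? h′ (x , y)))

  isVHC? : Decidable IsVHC
  isVHC? H = map′
    (λ (a , b , c , d) → record
      { hooks = a ; sw⇔top = λ i → uncurry mk⇔ (b i) ; nothingOver = c ; noCrossing = d })
    (λ v → let open IsVHC v in
      hooks , (λ i → Equivalence.to (sw⇔top i) , Equivalence.from (sw⇔top i))
            , nothingOver , noCrossing)
    (      (all? λ i → all? λ j → (j ∈? lookup H i) →-dec isHook? (i , j))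
     ×-dec (all? λ i → let sw? = any? (λ j → j ∈? lookup H i) in
              (sw? →-dec descentTop? π i) ×-dec (descentTop? π i →-dec sw?))
     ×-dec (all? λ i → all? λ j → (j ∈? lookup H i) →-dec
              ¬? (any? λ l → (i Fin.<? l) ×-dec (l Fin.<? j)
                             ×-dec (lookup π j Fin.<? lookup π l)))
     ×-dec (all? λ i → all? λ j → all? λ i′ → all? λ j′ →
              (j ∈? lookup H i) →-dec ((j′ ∈? lookup H i′) →-dec
              (¬? (≡-dec Fin._≟_ Fin._≟_ (i , j) (i′ , j′)) →-dec
              meetOnlyAtEndpoints? (i , j) (i′ , j′)))))

  isReduced? : Decidable IsReduced
  isReduced? H = all? λ p →
    any? (λ j → j ∈? lookup H p) ⊎-dec
    any? (λ i → p ∈? lookup H i) ⊎-dec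
    descentBottom? π p

-- A configuration carries its underlying permutation.
Configuration : ℕ → Set
Configuration n = OneLine n × HookSet n

configurations : ∀ n → Listing (Configuration n)
configurations n = vecs (fins n) n ⊗ vecs (subsets n) n

RedVHC : ∀ {n} → ℕ → Pred (OneLine n) 0ℓ → Pred (Configuration n) 0ℓ
RedVHC k S (π , H) = S π × IsVHC π H × IsReduced π H × hookCount H ≡ k

redVHC? : ∀ {n} k {S : Pred (OneLine n) 0ℓ} → Decidable S → Decidable (RedVHC k S)
redVHC? k S? (π , H) =
  S? π ×-dec isVHC? π H ×-dec isReduced? π H ×-dec (hookCount H ℕ.≟ k)

∣RedVHC∣ : ∀ {n} → ℕ → {S : Pred (OneLine n) 0ℓ} → Decidable S → ℕ
∣RedVHC∣ {n} k S? = card (configurations n) (redVHC? k S?)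

------------------------------------------------------------------------
-- Duck words

data Letter : Set where
  X Y Z : Letter

infix 4 _≟ˡ_
_≟ˡ_ : DecidableEquality Letter
X ≟ˡ X = yes refl
X ≟ˡ Y = no λ ()
X ≟ˡ Z = no λ ()
Y ≟ˡ X = no λ ()
Y ≟ˡ Y = yes refl
Y ≟ˡ Z = no λ ()
Z ≟ˡ X = no λ ()
Z ≟ˡ Y = no λ ()
Z ≟ˡ Z = yes refl

letters : Listing Letter
letters = record
  { elements = X ∷ Y ∷ Z ∷ []
  ; unique   = ((λ ()) ∷ (λ ()) ∷ []) ∷ ((λ ()) ∷ []) ∷ [] ∷ []
  ; complete = λ { X → here refl ; Y → there (here refl) ; Z → there (there (here refl)) }
  }

occurrences : Letter → List Letter → ℕ
occurrences ℓ w = length (filter (_≟ˡ ℓ) w)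

Ballot : Pred (List Letter) 0ℓ
Ballot u = occurrences Y u ≤ occurrences X u × occurrences Z u ≤ occurrences Y u

Word : ℕ → Set
Word k = Vec Letter (3 * k)

module _ (k : ℕ) where

  Is3DDyck : Pred (Word k) 0ℓ
  Is3DDyck w = (∀ ℓ → occurrences ℓ (toList w) ≡ k) × All Ballot (inits (toList w))

  -- A Y with no X immediately before it.
  BareY : Word k → Pred (Fin (3 * k)) 0ℓ
  BareY w p = lookup w p ≡ Y × ¬ (∃[ q ] q ⋖ p × lookup w q ≡ X)

  bareY? : ∀ w → Decidable (BareY w)
  bareY? w p = (lookup w p ≟ˡ Y) ×-dec ¬? (any? λ q → (q ⋖? p) ×-dec (lookup w q ≟ˡ X))

  IsDuck : ℕ → Pred (Word k) 0ℓ
  IsDuck j w = Is3DDyck w × card (fins (3 * k)) (bareY? w) ≡ j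

  -- The subset holds the positions of the underlined letters.
  IsUnderlinedDuck : ℕ → Pred (Word k × Subset (3 * k)) 0ℓ
  IsUnderlinedDuck i (w , U) = Is3DDyck w × (∀ p → p ∈ U → BareY w p) × ∣ U ∣ ≡ i

  is3DDyck? : Decidable Is3DDyck
  is3DDyck? w =
    map′ (λ { (x , y , z) → λ { X → x ; Y → y ; Z → z } }) (λ f → f X , f Y , f Z)
      (occ? X ×-dec occ? Y ×-dec occ? Z)
    ×-dec All.all? ballot? (inits (toList w))
    where
    occ? : ∀ ℓ → Dec (occurrences ℓ (toList w) ≡ k)
    occ? ℓ = occurrences ℓ (toList w) ℕ.≟ k

    ballot? : Decidable Ballot
    ballot? u = (occurrences Y u ℕ.≤? occurrences X u)
          ×-dec (occurrences Z u ℕ.≤? occurrences Y u)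

  isDuck? : ∀ j → Decidable (IsDuck j)
  isDuck? j w = is3DDyck? w ×-dec (card (fins (3 * k)) (bareY? w) ℕ.≟ j)

  isUnderlinedDuck? : ∀ i → Decidable (IsUnderlinedDuck i)
  isUnderlinedDuck? i (w , U) =
    is3DDyck? w ×-dec (all? λ p → (p ∈? U) →-dec bareY? w p) ×-dec (∣ U ∣ ℕ.≟ i)

  words : Listing (Word k)
  words = vecs letters (3 * k)

  Duck : ℕ → ℕ
  Duck j = card words (isDuck? j)

  UnderlinedDuck : ℕ → ℕ
  UnderlinedDuck i = card (words ⊗ subsets (3 * k)) (isUnderlinedDuck? i)

-- The sum of f over a ≤ j < b.
∑[_≤j<_] : ℕ → ℕ → (ℕ → ℕ) → ℕ
∑[ a ≤j< b ] f = ℕ.sum (applyUpTo (λ d → f (a + d)) (b ∸ a))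

module Submission where

-- A 312-avoiding permutation is the order in which a stack fed with 0, 1, 2, … is emptied.  Its
-- left-to-right maxima are the values that leave as soon as they enter, and all other points are
-- descent bottoms.  In a valid hook configuration NE endpoints are left-to-right maxima, and hooks
-- nest like parentheses, so a second stack holds the SW endpoints of the hooks still open.  Reducedness
-- says that a left-to-right maximum without NE endpoint is followed by a descent.  Hence a
-- configuration is a word: X pushes a value, Z outputs a new value and closes a hook there, Y outputs a
-- new value and then pops one, and an underlined Y only pops one; both kinds of Y open a hook at the
-- point before the popped one.  A pop must follow an output, so an underlined Y cannot follow an X, and
-- the two stacks never underflow exactly when the word is a 3D-Dyck word.  It has 3k − i points if i of
-- the Y's are underlined.
--
-- The second equality chooses the i underlined Y's among the j bare ones; j < k because the first Y of
-- a 3D-Dyck word follows an X.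

open import Defs
open import Data.Bool.Base using (Bool; true; false; if_then_else_)
open import Data.Empty using (⊥)
open import Data.Fin.Base using (Fin; zero; suc; toℕ; fromℕ<; punchOut) renaming (_<_ to _<ᶠ_; _≤_ to _≤ᶠ_)
import Data.Fin.Properties as Fin
open import Data.Fin.Subset as Subset using (Subset; ∣_∣)
import Data.Fin.Subset.Properties as Subset
open import Data.List.Base as List using (List; []; _∷_; _++_; length; filter; map; allFin; inits; cartesianProductWith; applyUpTo)
open import Data.List.Membership.Propositional using (_∈_)
open import Data.List.Membership.Propositional.Properties using (∈-lookup; ∈-filter⁺; ∈-filter⁻)
import Data.List.Properties as List
open import Data.List.Relation.Unary.All as All using (All; []; _∷_)
import Data.List.Relation.Unary.All.Properties as All
open import Data.List.Relation.Unary.AllPairs using (AllPairs; []; _∷_)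
open import Data.List.Relation.Unary.Any using (index; here; there)
open import Data.List.Relation.Unary.Any.Properties using (lookup-index)
open import Data.List.Relation.Unary.Unique.Propositional using (Unique)
import Data.List.Relation.Unary.Unique.Propositional.Properties as Unique
open import Data.Maybe.Base using (Maybe; just; nothing)
open import Data.Maybe.Properties as Maybe using (just-injective)
open import Data.Nat.Base
open import Data.Nat.Combinatorics using (_C_; nCk+nC[k+1]≡[n+1]C[k+1]; k>n⇒nCk≡0)
import Data.Nat.ListAction as ℕ
open import Data.Nat.Properties
open import Data.Product.Base using (_×_; _,_; ∃-syntax; proj₁; proj₂)
open import Data.Sum.Base using (_⊎_; inj₁; inj₂)
open import Data.Vec.Base as Vec using (Vec; []; _∷_; here; there; lookup; toList; zip)
import Data.Vec.Properties as Vec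
open import Function.Base using (_∘_; case_of_)
open import Function.Bundles using (mk⇔; Equivalence)
open import Level using (0ℓ)
open import Relation.Binary.Definitions using (tri<; tri≈; tri>)
open import Relation.Binary.PropositionalEquality
open import Relation.Nullary.Decidable using (Dec; yes; no; does; _×-dec_; dec-true; dec-false)
open import Relation.Nullary.Negation using (¬_; contradiction)
open import Relation.Unary using (Pred; Decidable; _≐_)

open import Algebra.Properties.CommutativeMonoid.Sum +-0-commutativeMonoid
  using (sum; sum-cong-≗; ∑-comm; sum-replicate-zero)

open Listing

-- Cardinalities and binomial sums

lookup-injective : ∀ {A : Set} {xs : List A} → Unique xs →
  ∀ {i j} → List.lookup xs i ≡ List.lookup xs j → i ≡ j
lookup-injective (_ ∷ _)    {zero}  {zero}  _  = refl
lookup-injective (x∉ ∷ _)   {zero}  {suc j} eq = contradiction eq (All.lookup x∉ (∈-lookup j))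
lookup-injective (x∉ ∷ _)   {suc i} {zero}  eq = contradiction (sym eq) (All.lookup x∉ (∈-lookup i))
lookup-injective (_ ∷ uniq) {suc i} {suc j} eq = cong suc (lookup-injective uniq eq)

module _ {A B : Set} (L : Listing A) (M : Listing B)
         {P : Pred A 0ℓ} {Q : Pred B 0ℓ} (P? : Decidable P) (Q? : Decidable Q) where

  -- A relation replaces a map so that the single relation `Encodes`, read in both directions,
  -- yields both inequalities of the bijection.
  card-≤ : (R : A → B → Set) →
    (∀ a → P a → ∃[ b ] Q b × R a b) →
    (∀ {a a′ b} → R a b → R a′ b → a ≡ a′) →
    card L P? ≤ card M Q?
  card-≤ R total injective = Fin.injective⇒≤ f-injective
    where
    xs = filter P? (elements L)
    ys = filter Q? (elements M)

    image : ∀ i → ∃[ b ] Q b × R (List.lookup xs i) b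
    image i = total _ (proj₂ (∈-filter⁻ P? {xs = elements L} (∈-lookup i)))

    image∈ : ∀ i → proj₁ (image i) ∈ ys
    image∈ i = ∈-filter⁺ Q? (complete M _) (proj₁ (proj₂ (image i)))

    f : Fin (length xs) → Fin (length ys)
    f i = index (image∈ i)

    f-injective : ∀ {i j} → f i ≡ f j → i ≡ j
    f-injective {i} {j} fi≡fj = lookup-injective (Unique.filter⁺ P? (unique L))
      (injective (proj₂ (proj₂ (image i)))
        (subst (R (List.lookup xs j)) (sym same) (proj₂ (proj₂ (image j)))))
      where
      same : proj₁ (image i) ≡ proj₁ (image j)
      same = trans (lookup-index (image∈ i))
            (trans (cong (List.lookup ys) fi≡fj) (sym (lookup-index (image∈ j))))

module _ {A B : Set} {P : Pred B 0ℓ} (P? : Decidable P) where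

  length-filter-map : ∀ (f : A → B) xs →
    length (filter P? (map f xs)) ≡ length (filter (P? ∘ f) xs)
  length-filter-map f []       = refl
  length-filter-map f (x ∷ xs) with does (P? (f x))
  ... | true  = cong suc (length-filter-map f xs)
  ... | false = length-filter-map f xs

length-filter-cartesianProductWith :
  ∀ {A B D : Set} {P : Pred D 0ℓ} (P? : Decidable P) (f : A → B → D) xs ys →
  length (filter P? (cartesianProductWith f xs ys)) ≡
  ℕ.sum (map (λ x → length (filter (P? ∘ f x) ys)) xs)
length-filter-cartesianProductWith P? f []       ys = refl
length-filter-cartesianProductWith P? f (x ∷ xs) ys = begin
  length (filter P? (map (f x) ys ++ rest))
    ≡⟨ cong length (List.filter-++ P? (map (f x) ys) rest) ⟩
  length (filter P? (map (f x) ys) ++ filter P? rest)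
    ≡⟨ List.length-++ (filter P? (map (f x) ys)) ⟩
  length (filter P? (map (f x) ys)) + length (filter P? rest)
    ≡⟨ cong₂ _+_ (length-filter-map P? (f x) ys) (length-filter-cartesianProductWith P? f xs ys) ⟩
  _ ∎
  where
  open ≡-Reasoning
  rest = cartesianProductWith f xs ys

card-fins-suc : ∀ {n} {P : Pred (Fin (suc n)) 0ℓ} (P? : Decidable P) →
  length (filter P? (List.tabulate suc)) ≡ card (fins n) (P? ∘ suc)
card-fins-suc {n} P? =
  trans (cong (length ∘ filter P?) (sym (List.map-tabulate (λ i → i) suc)))
        (length-filter-map P? suc (allFin n))

∣tabulate-does∣ : ∀ {n} {P : Pred (Fin n) 0ℓ} (P? : Decidable P) →
  ∣ Vec.tabulate (does ∘ P?) ∣ ≡ card (fins n) P?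
∣tabulate-does∣ {zero}  P? = refl
∣tabulate-does∣ {suc n} P? with does (P? zero)
... | true  = cong suc (trans (∣tabulate-does∣ (P? ∘ suc)) (sym (card-fins-suc P?)))
... | false = trans (∣tabulate-does∣ (P? ∘ suc)) (sym (card-fins-suc P?))

module _ {n} {P : Pred (Fin n) 0ℓ} (P? : Decidable P) where

  ∈-tabulate-does⁻ : ∀ {p} → p Subset.∈ Vec.tabulate (does ∘ P?) → P p
  ∈-tabulate-does⁻ {p} p∈ with P? p | trans (sym (Vec.lookup∘tabulate (does ∘ P?) p)) (Vec.[]=⇒lookup p∈)
  ... | yes Pp | _ = Pp

  ∈-tabulate-does⁺ : ∀ {p} → P p → p Subset.∈ Vec.tabulate (does ∘ P?)
  ∈-tabulate-does⁺ {p} Pp =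
    Vec.lookup⇒[]= p _ (trans (Vec.lookup∘tabulate (does ∘ P?) p) (dec-true (P? p) Pp))

SubsetOf : ∀ {n} → Pred (Fin n) 0ℓ → ℕ → Pred (Subset n) 0ℓ
SubsetOf P i U = (∀ p → p Subset.∈ U → P p) × ∣ U ∣ ≡ i

-- Pascal's rule, according to whether position zero is in the subset. `Q` is given only up to `≐`
-- because the count depends on a particular decision procedure: in the recursion it is `Q?`
-- composed with `false ∷_` or `true ∷_`, in the application it is `isUnderlinedDuck?` at a fixed
-- word.
card-subsets : ∀ {n} {P : Pred (Fin n) 0ℓ} (P? : Decidable P) i
  {Q : Pred (Subset n) 0ℓ} (Q? : Decidable Q) → Q ≐ SubsetOf P i →
  card (subsets n) Q? ≡ card (fins n) P? C i
card-subsets {zero} P? i Q? (to , from) with Q? []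
card-subsets {zero} P? i       Q? (to , from) | yes q with refl ← proj₂ (to q) = refl
card-subsets {zero} P? zero    Q? (to , from) | no ¬q = contradiction (from ((λ ()) , refl)) ¬q
card-subsets {zero} P? (suc i) Q? (to , from) | no ¬q = refl
card-subsets {suc n} {P} P? i {Q} Q? (to , from) = begin
  card (subsets (suc n)) Q?
    ≡⟨ length-filter-cartesianProductWith Q? _∷_ (elements bools) (elements (subsets n)) ⟩
  card (subsets n) (Q? ∘ (false ∷_)) + (card (subsets n) (Q? ∘ (true ∷_)) + 0)
    ≡⟨ cong₂ _+_ without (+-identityʳ _) ⟩
  rest C i + card (subsets n) (Q? ∘ (true ∷_))
    ≡⟨ with-zero i refl ⟩
  card (fins (suc n)) P? C i ∎
  where
  open ≡-Reasoning
  rest = card (fins n) (P? ∘ suc)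

  without : card (subsets n) (Q? ∘ (false ∷_)) ≡ rest C i
  without = card-subsets (P? ∘ suc) i (Q? ∘ (false ∷_))
    ( (λ q → (λ p p∈U → proj₁ (to q) (suc p) (there p∈U)) , proj₂ (to q))
    , (λ (sub , size) → from ((λ { (suc p) (there p∈U) → sub p p∈U }) , size)))

  none : (∀ U → ¬ Q (true ∷ U)) → card (subsets n) (Q? ∘ (true ∷_)) ≡ 0
  none ¬Q = cong length (List.filter-none (Q? ∘ (true ∷_)) {xs = elements (subsets n)} (All.universal ¬Q _))

  -- `j` is a copy of `i` that can be split while `to` and `from` still speak of `i`.
  with-zero : ∀ j → j ≡ i → rest C j + card (subsets n) (Q? ∘ (true ∷_)) ≡ card (fins (suc n)) P? C j
  with-zero j j≡i with P? zero
  with-zero j j≡i | no ¬p = begin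
    rest C j + card (subsets n) (Q? ∘ (true ∷_))
      ≡⟨ cong (rest C j +_) (none λ U q → ¬p (proj₁ (to q) zero here)) ⟩
    rest C j + 0
      ≡⟨ +-identityʳ _ ⟩
    rest C j
      ≡⟨ cong (_C j) (card-fins-suc P?) ⟨
    _ ∎
  with-zero zero 0≡i | yes p =
    cong suc (none λ U q → case trans 0≡i (sym (proj₂ (to q))) of λ ())
  with-zero (suc j) 1+j≡i | yes p = begin
    rest C suc j + card (subsets n) (Q? ∘ (true ∷_))
      ≡⟨ +-comm (rest C suc j) _ ⟩
    card (subsets n) (Q? ∘ (true ∷_)) + rest C suc j
      ≡⟨ cong (_+ rest C suc j) (card-subsets (P? ∘ suc) j (Q? ∘ (true ∷_))
          ( (λ q → (λ r r∈U → proj₁ (to q) (suc r) (there r∈U))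
                 , suc-injective (trans (proj₂ (to q)) (sym 1+j≡i)))
          , (λ (sub , size) → from ((λ { zero here → p ; (suc r) (there r∈U) → sub r r∈U })
                                   , trans (cong suc size) 1+j≡i)))) ⟩
    rest C j + rest C suc j
      ≡⟨ nCk+nC[k+1]≡[n+1]C[k+1] rest j ⟩
    suc rest C suc j
      ≡⟨ cong (λ r → suc r C suc j) (card-fins-suc P?) ⟨
    _ ∎

sum-applyUpTo-zero : ∀ f n → (∀ d → f d ≡ 0) → ℕ.sum (applyUpTo f n) ≡ 0
sum-applyUpTo-zero f zero    f≡0 = refl
sum-applyUpTo-zero f (suc n) f≡0 = cong₂ _+_ (f≡0 0) (sum-applyUpTo-zero (f ∘ suc) n (f≡0 ∘ suc))

sum-applyUpTo-single : ∀ f {b n} → b < n → (∀ d → d ≢ b → f d ≡ 0) → ℕ.sum (applyUpTo f n) ≡ f b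
sum-applyUpTo-single f {zero}  {suc n} _         f≡0 =
  trans (cong (f 0 +_) (sum-applyUpTo-zero (f ∘ suc) n (λ d → f≡0 (suc d) λ ()))) (+-identityʳ _)
sum-applyUpTo-single f {suc b} {suc n} (s≤s b<n) f≡0 =
  cong₂ _+_ (f≡0 0 λ ()) (sum-applyUpTo-single (f ∘ suc) b<n (λ d d≢b → f≡0 (suc d) (d≢b ∘ suc-injective)))

sum-applyUpTo-+ : ∀ {f g h : ℕ → ℕ} n → (∀ d → h d ≡ f d + g d) →
  ℕ.sum (applyUpTo h n) ≡ ℕ.sum (applyUpTo f n) + ℕ.sum (applyUpTo g n)
sum-applyUpTo-+             zero    h≡ = refl
sum-applyUpTo-+ {f} {g} {h} (suc n) h≡ = begin
  h 0 + ℕ.sum (applyUpTo (h ∘ suc) n)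
    ≡⟨ cong₂ _+_ (h≡ 0) (sum-applyUpTo-+ n (h≡ ∘ suc)) ⟩
  (f 0 + g 0) + (ℕ.sum (applyUpTo (f ∘ suc) n) + ℕ.sum (applyUpTo (g ∘ suc) n))
    ≡⟨ +-interchange (f 0) (g 0) _ _ ⟩
  _ ∎
  where
  open ≡-Reasoning
  open import Algebra.Properties.CommutativeSemigroup +-commutativeSemigroup
    using () renaming (interchange to +-interchange)

-- The index `j` may lie below the range; the sum is then zero term by term, and `low` makes the
-- right side zero too.
∑-single : ∀ f {a b j} → (j < a → f j ≡ 0) → j < b → (∀ d → d ≢ j → f d ≡ 0) → ∑[ a ≤j< b ] f ≡ f j
∑-single f {a} {b} {j} low j<b f≡0 with a ≤? j
... | yes a≤j = begin
  ∑[ a ≤j< b ] f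
    ≡⟨ sum-applyUpTo-single (λ d → f (a + d)) (∸-monoˡ-< j<b a≤j)
         (λ d d≢ → f≡0 (a + d) λ a+d≡j → d≢ (trans (sym (m+n∸m≡n a d)) (cong (_∸ a) a+d≡j))) ⟩
  f (a + (j ∸ a))
    ≡⟨ cong f (m+[n∸m]≡n a≤j) ⟩
  f j ∎
  where open ≡-Reasoning
... | no a≰j = trans
  (sum-applyUpTo-zero _ (b ∸ a) λ d → f≡0 (a + d) λ a+d≡j → a≰j (subst (a ≤_) a+d≡j (m≤m+n a d)))
  (sym (low (≰⇒> a≰j)))

module _ {A : Set} {D : Pred A 0ℓ} (D? : Decidable D) (b g : A → ℕ) (c : ℕ → ℕ) {lo hi : ℕ}
  (below : ∀ j → j < lo → c j ≡ 0) (b< : ∀ a → D a → b a < hi)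
  (g-in : ∀ a → D a → g a ≡ c (b a)) (g-out : ∀ a → ¬ D a → g a ≡ 0) where

  fibre? : ∀ j → Decidable (λ a → D a × b a ≡ j)
  fibre? j a = D? a ×-dec (b a ≟ j)

  -- Double counting: an entry satisfying `D` contributes to the right only at the index given by
  -- its value of `b`. Starting at `lo` loses nothing because `c` vanishes below.
  sum-by-fibres : ∀ xs →
    ℕ.sum (map g xs) ≡ ∑[ lo ≤j< hi ] (λ j → c j * length (filter (fibre? j) xs))
  sum-by-fibres []       = sym (sum-applyUpTo-zero _ (hi ∸ lo) (λ d → *-zeroʳ (c (lo + d))))
  sum-by-fibres (x ∷ xs) = trans (cong₂ _+_ (sym step) (sum-by-fibres xs))
                                 (sym (sum-applyUpTo-+ (hi ∸ lo) (λ d → split (lo + d))))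
    where
    δ : ℕ → ℕ
    δ j = length (filter (fibre? j) List.[ x ])

    split : ∀ j → c j * length (filter (fibre? j) (x ∷ xs)) ≡
                  c j * δ j + c j * length (filter (fibre? j) xs)
    split j = trans
      (cong (c j *_) (trans (cong length (List.filter-++ (fibre? j) List.[ x ] xs))
                            (List.length-++ (filter (fibre? j) List.[ x ]))))
      (*-distribˡ-+ (c j) (δ j) _)

    δ-off : ∀ j → ¬ (D x × b x ≡ j) → c j * δ j ≡ 0
    δ-off j ∉ = trans (cong (λ l → c j * length l) (List.filter-reject (fibre? j) ∉)) (*-zeroʳ (c j))

    step′ : Dec (D x) → ∑[ lo ≤j< hi ] (λ j → c j * δ j) ≡ g x
    step′ (no ¬d) = trans
      (sum-applyUpTo-zero _ (hi ∸ lo) (λ d → δ-off (lo + d) (¬d ∘ proj₁)))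
      (sym (g-out x ¬d))
    step′ (yes d) = begin
      ∑[ lo ≤j< hi ] (λ j → c j * δ j)
        ≡⟨ ∑-single _ (λ lt → cong (_* δ (b x)) (below _ lt)) (b< x d)
             (λ j j≢ → δ-off j (j≢ ∘ sym ∘ proj₂)) ⟩
      c (b x) * δ (b x)
        ≡⟨ cong (λ l → c (b x) * length l) (List.filter-accept (fibre? (b x)) (d , refl)) ⟩
      c (b x) * 1
        ≡⟨ *-identityʳ _ ⟩
      c (b x)
        ≡⟨ g-in x d ⟨
      g x ∎
      where open ≡-Reasoning

    step : ∑[ lo ≤j< hi ] (λ j → c j * δ j) ≡ g x
    step = step′ (D? x)

-- A Dyck word with j bare Y's has `j C i` admissible underlinings. Summing over words and grouping
-- them by j gives the formula; the hypothesis keeps every j in the range of summation.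
UnderlinedDuck≡∑Duck : ∀ k i → (∀ w → Is3DDyck k w → card (fins (3 * k)) (bareY? k w) < k) →
  UnderlinedDuck k i ≡ ∑[ i ≤j< k ] (λ j → (j C i) * Duck k j)
UnderlinedDuck≡∑Duck k i bare<k = trans
  (length-filter-cartesianProductWith (isUnderlinedDuck? k i) _,_ (elements (words k)) (elements (subsets (3 * k))))
  (sum-by-fibres (is3DDyck? k) (λ w → card (fins (3 * k)) (bareY? k w)) _ (_C i) {lo = i}
    (λ j j<i → k>n⇒nCk≡0 j<i) bare<k
    (λ w d → card-subsets (bareY? k w) i (λ U → isUnderlinedDuck? k i (w , U))
      ((λ (_ , sub , size) → sub , size) , (λ (sub , size) → d , sub , size)))
    (λ w ¬d → cong length (List.filter-none (λ U → isUnderlinedDuck? k i (w , U))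
      {xs = elements (subsets (3 * k))} (All.universal (λ _ q → ¬d (proj₁ q)) _)))
    (elements (words k)))

-- Underlined duck words as lattice paths

-- The Boolean records whether the letter is underlined.
Label : Set
Label = Letter × Bool

-- Path s h ℓ l: the labelled word l can follow a prefix that ends in ℓ and in which the
-- X's exceed the Y's by s and the Y's exceed the Z's by h.
data Path : (s h : ℕ) → Letter → List Label → Set where
  end    : ∀ {ℓ} → Path 0 0 ℓ []
  X∷     : ∀ {s h ℓ l} → Path (suc s) h X l → Path s h ℓ ((X , false) ∷ l)
  Y∷     : ∀ {s h ℓ l} → Path s (suc h) Y l → Path (suc s) h ℓ ((Y , false) ∷ l)
  under∷ : ∀ {s h ℓ l} → ℓ ≢ X → Path s (suc h) Y l → Path (suc s) h ℓ ((Y , true) ∷ l)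
  Z∷     : ∀ {s h ℓ l} → Path s h Z l → Path s (suc h) ℓ ((Z , false) ∷ l)

BallotFrom : (s h : ℕ) → Pred (List Letter) 0ℓ
BallotFrom s h u = occurrences Y u ≤ s + occurrences X u × occurrences Z u ≤ h + occurrences Y u

-- ℓ is the letter before the first one.
UnderlinesAllowed : ∀ {m} → Letter → Vec Letter m → Subset m → Set
UnderlinesAllowed ℓ w U = ∀ p → p Subset.∈ U →
  lookup w p ≡ Y × ¬ (∃[ q ] q ⋖ p × lookup w q ≡ X) × (toℕ p ≡ 0 → ℓ ≢ X)

module _ {m : ℕ} {x : Letter} {w : Vec Letter m} {b : Bool} {U : Subset m} {ℓ : Letter} where

  allowed-tail : UnderlinesAllowed ℓ (x ∷ w) (b ∷ U) → UnderlinesAllowed x w U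
  allowed-tail ok p p∈U with eq , bare , _ ← ok (suc p) (there p∈U) =
    eq , (λ (q , q⋖p , q≡X) → bare (suc q , cong suc q⋖p , q≡X))
       , (λ p≡0 x≡X → bare (zero , cong suc p≡0 , x≡X))

  allowed-cons : (b ≡ true → x ≡ Y × ℓ ≢ X) → UnderlinesAllowed x w U → UnderlinesAllowed ℓ (x ∷ w) (b ∷ U)
  allowed-cons first ok zero here with x≡Y , ℓ≢X ← first refl =
    x≡Y , (λ { (_ , () , _) }) , (λ _ → ℓ≢X)
  allowed-cons first ok (suc p) (there p∈U) with eq , bare , p≢ ← ok p p∈U =
    eq , (λ { (zero , q⋖p , q≡X) → p≢ (suc-injective q⋖p) q≡X
            ; (suc q , q⋖p , q≡X) → bare (q , suc-injective q⋖p , q≡X) })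
       , λ ()

Balanced : (s h : ℕ) → Pred (List Letter) 0ℓ
Balanced s h u = s + occurrences X u ≡ occurrences Y u × h + occurrences Y u ≡ occurrences Z u

ballots-tail : ∀ {s h s′ h′ : ℕ} x w → (∀ u → BallotFrom s h (x ∷ u) → BallotFrom s′ h′ u) →
  All (BallotFrom s h) (inits (x ∷ w)) → All (BallotFrom s′ h′) (inits w)
ballots-tail x w step (_ ∷ bs) = All.map (λ {u} → step u) (All.map⁻ bs)

ballots-cons : ∀ {s h s′ h′ : ℕ} x w → (∀ u → BallotFrom s′ h′ u → BallotFrom s h (x ∷ u)) →
  All (BallotFrom s′ h′) (inits w) → All (BallotFrom s h) (inits (x ∷ w))
ballots-cons x w step bs = (z≤n , z≤n) ∷ All.map⁺ (All.map (λ {u} → step u) bs)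

-- The ballot condition on the prefix of length one excludes a Y when `s` is 0 and a Z when `h` is
-- 0; the conditions on the longer prefixes pass to the tail with shifted surpluses.
word⇒path : ∀ {m s h ℓ} (w : Vec Letter m) (U : Subset m) →
  All (BallotFrom s h) (inits (toList w)) → Balanced s h (toList w) →
  UnderlinesAllowed ℓ w U → Path s h ℓ (toList (zip w U))
word⇒path {s = s} {h} [] [] _ (bX , bY) _
  with refl ← trans (sym (+-identityʳ s)) bX
  with refl ← trans (sym (+-identityʳ h)) bY = end
word⇒path (X ∷ w) (true ∷ U) bs bal ok with () ← proj₁ (ok zero here)
word⇒path (Z ∷ w) (true ∷ U) bs bal ok with () ← proj₁ (ok zero here)
word⇒path {s = s} (X ∷ w) (false ∷ U) bs (bX , bY) ok = X∷ (word⇒path w U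
  (ballots-tail X (toList w) (λ u (b , b′) → subst (occurrences Y u ≤_) (+-suc s _) b , b′) bs)
  (trans (sym (+-suc s _)) bX , bY)
  (allowed-tail ok))
word⇒path {s = zero} (Y ∷ w) (b ∷ U) (_ ∷ (() , _) ∷ _) bal ok
word⇒path {s = suc s} {h} (Y ∷ w) (false ∷ U) bs (bX , bY) ok = Y∷ (word⇒path w U
  (ballots-tail Y (toList w) (λ u (b , b′) → s≤s⁻¹ b , subst (occurrences Z u ≤_) (+-suc h _) b′) bs)
  (suc-injective bX , trans (sym (+-suc h _)) bY)
  (allowed-tail ok))
word⇒path {s = suc s} {h} (Y ∷ w) (true ∷ U) bs (bX , bY) ok =
  under∷ (proj₂ (proj₂ (ok zero here)) refl) (word⇒path w U
  (ballots-tail Y (toList w) (λ u (b , b′) → s≤s⁻¹ b , subst (occurrences Z u ≤_) (+-suc h _) b′) bs)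
  (suc-injective bX , trans (sym (+-suc h _)) bY)
  (allowed-tail ok))
word⇒path {h = zero} (Z ∷ w) (b ∷ U) (_ ∷ (_ , ()) ∷ _) bal ok
word⇒path {h = suc h} (Z ∷ w) (false ∷ U) bs (bX , bY) ok = Z∷ (word⇒path w U
  (ballots-tail Z (toList w) (λ u (b , b′) → b , s≤s⁻¹ b′) bs)
  (bX , suc-injective bY)
  (allowed-tail ok))

path⇒word : ∀ {m s h ℓ} (w : Vec Letter m) (U : Subset m) → Path s h ℓ (toList (zip w U)) →
  All (BallotFrom s h) (inits (toList w)) × Balanced s h (toList w) × UnderlinesAllowed ℓ w U
path⇒word [] [] end = (z≤n , z≤n) ∷ [] , (refl , refl) , λ ()
path⇒word {s = s} (X ∷ w) (false ∷ U) (X∷ path)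
  with bs , (bX , bY) , ok ← path⇒word w U path =
  ballots-cons X (toList w) (λ u (b , b′) → subst (occurrences Y u ≤_) (sym (+-suc s _)) b , b′) bs
  , (trans (+-suc s _) bX , bY) , allowed-cons (λ ()) ok
path⇒word {h = h} (Y ∷ w) (false ∷ U) (Y∷ path)
  with bs , (bX , bY) , ok ← path⇒word w U path =
  ballots-cons Y (toList w) (λ u (b , b′) → s≤s b , subst (occurrences Z u ≤_) (sym (+-suc h _)) b′) bs
  , (cong suc bX , trans (+-suc h _) bY) , allowed-cons (λ ()) ok
path⇒word {h = h} (Y ∷ w) (true ∷ U) (under∷ ℓ≢X path)
  with bs , (bX , bY) , ok ← path⇒word w U path =
  ballots-cons Y (toList w) (λ u (b , b′) → s≤s b , subst (occurrences Z u ≤_) (sym (+-suc h _)) b′) bs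
  , (cong suc bX , trans (+-suc h _) bY) , allowed-cons (λ _ → refl , ℓ≢X) ok
path⇒word (Z ∷ w) (false ∷ U) (Z∷ path)
  with bs , (bX , bY) , ok ← path⇒word w U path =
  ballots-cons Z (toList w) (λ u (b , b′) → b , s≤s b′) bs
  , (bX , cong suc bY) , allowed-cons (λ ()) ok

occurrences-total : ∀ {m} (w : Vec Letter m) →
  occurrences X (toList w) + occurrences Y (toList w) + occurrences Z (toList w) ≡ m
occurrences-total []      = refl
occurrences-total (X ∷ w) = cong suc (occurrences-total w)
occurrences-total (Y ∷ w) = trans
  (cong (_+ occurrences Z (toList w)) (+-suc (occurrences X (toList w)) _)) (cong suc (occurrences-total w))
occurrences-total (Z ∷ w) = trans
  (+-suc (occurrences X (toList w) + occurrences Y (toList w)) _) (cong suc (occurrences-total w))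

-- The number of positions of the permutation that a word spells out.
points : List Label → ℕ
points []                = 0
points ((X , _) ∷ l)     = points l
points ((Y , false) ∷ l) = 2 + points l
points ((Y , true) ∷ l)  = 1 + points l
points ((Z , _) ∷ l)     = 1 + points l

-- A plain Y contributes two points, an underlined one a point and an element of `U`, so every Y
-- counts twice.
points+∣U∣ : ∀ {m s h ℓ} (w : Vec Letter m) (U : Subset m) → Path s h ℓ (toList (zip w U)) →
  points (toList (zip w U)) + ∣ U ∣ ≡
  occurrences Y (toList w) + occurrences Y (toList w) + occurrences Z (toList w)
points+∣U∣ [] [] end = refl
points+∣U∣ (X ∷ w) (false ∷ U) (X∷ path) = points+∣U∣ w U path
points+∣U∣ (Y ∷ w) (false ∷ U) (Y∷ path) = trans (cong (2 +_) (points+∣U∣ w U path))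
  (cong (λ y → suc (y + occurrences Z (toList w))) (sym (+-suc (occurrences Y (toList w)) _)))
points+∣U∣ (Y ∷ w) (true ∷ U) (under∷ _ path) =
  trans (cong suc (+-suc _ ∣ U ∣)) (trans (cong (2 +_) (points+∣U∣ w U path))
  (cong (λ y → suc (y + occurrences Z (toList w))) (sym (+-suc (occurrences Y (toList w)) _))))
points+∣U∣ (Z ∷ w) (false ∷ U) (Z∷ path) = trans (cong suc (points+∣U∣ w U path))
  (sym (+-suc (occurrences Y (toList w) + occurrences Y (toList w)) _))

∣U∣≤occurrences : ∀ {m s h ℓ} (w : Vec Letter m) (U : Subset m) → Path s h ℓ (toList (zip w U)) →
  ∣ U ∣ ≤ occurrences Y (toList w)
∣U∣≤occurrences [] [] end = z≤n
∣U∣≤occurrences (X ∷ w) (false ∷ U) (X∷ path) = ∣U∣≤occurrences w U path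
∣U∣≤occurrences (Y ∷ w) (false ∷ U) (Y∷ path) = m≤n⇒m≤1+n (∣U∣≤occurrences w U path)
∣U∣≤occurrences (Y ∷ w) (true ∷ U) (under∷ _ path) = s≤s (∣U∣≤occurrences w U path)
∣U∣≤occurrences (Z ∷ w) (false ∷ U) (Z∷ path) = ∣U∣≤occurrences w U path

-- The first Y of a Dyck word follows an X.
∣U∣<occurrences : ∀ {m s} (w : Vec Letter m) (U : Subset m) → Path (suc s) 0 X (toList (zip w U)) →
  ∣ U ∣ < occurrences Y (toList w)
∣U∣<occurrences [] [] ()
∣U∣<occurrences (X ∷ w) (false ∷ U) (X∷ path) = ∣U∣<occurrences w U path
∣U∣<occurrences (Y ∷ w) (false ∷ U) (Y∷ path) = s≤s (∣U∣≤occurrences w U path)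
∣U∣<occurrences (Y ∷ w) (true ∷ U) (under∷ X≢X path) = contradiction refl X≢X

∣U∣<occurrences₀ : ∀ {m ℓ} (w : Vec Letter m) (U : Subset m) → Path 0 0 ℓ (toList (zip w U)) →
  0 < m → ∣ U ∣ < occurrences Y (toList w)
∣U∣<occurrences₀ (X ∷ w) (false ∷ U) (X∷ path) _ = ∣U∣<occurrences w U path

-- Without surplus X's the path cannot begin with a Y, so the preceding letter is immaterial. This
-- adapts the start of a path to the phase `pushed`, in which a run begins.
start-after-X : ∀ {h ℓ l} → Path 0 h ℓ l → Path 0 h X l
start-after-X end      = end
start-after-X (X∷ path) = X∷ path
start-after-X (Z∷ path) = Z∷ path

module _ {k i : ℕ} {w : Word k} {U : Subset (3 * k)} where

  -- The fictitious letter before the word is a Y, since `BareY` also counts a Y in first position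
  -- as bare.
  duck⇒path : IsUnderlinedDuck k i (w , U) → Path 0 0 Y (toList (zip w U))
  duck⇒path ((occ , ballots) , bare , _) = word⇒path w U ballots
    (trans (occ X) (sym (occ Y)) , trans (occ Y) (sym (occ Z)))
    (λ p p∈U → proj₁ (bare p p∈U) , proj₂ (bare p p∈U) , λ _ ())

  duck⇒points : IsUnderlinedDuck k i (w , U) → points (toList (zip w U)) + i ≡ 3 * k
  duck⇒points duck@((occ , _) , _ , refl) = begin
    points (toList (zip w U)) + ∣ U ∣
      ≡⟨ points+∣U∣ w U (duck⇒path duck) ⟩
    occurrences Y (toList w) + occurrences Y (toList w) + occurrences Z (toList w)
      ≡⟨ cong₂ _+_ (cong₂ _+_ (trans (occ Y) (sym (occ X))) refl) refl ⟩
    occurrences X (toList w) + occurrences Y (toList w) + occurrences Z (toList w)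
      ≡⟨ occurrences-total w ⟩
    3 * k ∎
    where open ≡-Reasoning

  -- Balance lets the number of Z's determine the other two counts. The size of `U` follows by
  -- cancelling the points from two expressions for `3 * k`.
  path⇒duck : Path 0 0 Y (toList (zip w U)) → occurrences Z (toList w) ≡ k →
    points (toList (zip w U)) + i ≡ 3 * k → IsUnderlinedDuck k i (w , U)
  path⇒duck path occZ pts with bs , (bX , bY) , ok ← path⇒word w U path =
    (occ , bs) , (λ p p∈U → proj₁ (ok p p∈U) , proj₁ (proj₂ (ok p p∈U)))
    , +-cancelˡ-≡ (points (toList (zip w U))) _ _ (begin
      points (toList (zip w U)) + ∣ U ∣
        ≡⟨ points+∣U∣ w U path ⟩
      occurrences Y (toList w) + occurrences Y (toList w) + occurrences Z (toList w)
        ≡⟨ cong₂ _+_ (cong₂ _+_ (sym bX) refl) refl ⟩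
      occurrences X (toList w) + occurrences Y (toList w) + occurrences Z (toList w)
        ≡⟨ occurrences-total w ⟩
      3 * k
        ≡⟨ pts ⟨
      points (toList (zip w U)) + i ∎)
    where
    open ≡-Reasoning
    occ : ∀ ℓ → occurrences ℓ (toList w) ≡ k
    occ X = trans bX (trans bY occZ)
    occ Y = trans bY occZ
    occ Z = occZ

-- The set of all bare Y's is itself an admissible underlining, so the strict bound on underlined
-- sets applies to it.
card-bareY< : ∀ {k} → 1 ≤ k → ∀ w → Is3DDyck k w → card (fins (3 * k)) (bareY? k w) < k
card-bareY< {k} 1≤k w dyck = begin-strict
  card (fins (3 * k)) (bareY? k w)
    ≡⟨ ∣tabulate-does∣ (bareY? k w) ⟨
  ∣ bare ∣
    <⟨ ∣U∣<occurrences₀ w bare (duck⇒path {k} {∣ bare ∣} (dyck , ∈bare , refl)) (≤-trans 1≤k (m≤m+n k _)) ⟩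
  occurrences Y (toList w)
    ≡⟨ proj₁ dyck Y ⟩
  k ∎
  where
  open ≤-Reasoning
  bare : Subset (3 * k)
  bare = Vec.tabulate (does ∘ bareY? k w)

  ∈bare : ∀ p → p Subset.∈ bare → BareY k w p
  ∈bare p = ∈-tabulate-does⁻ (bareY? k w)

-- Reading a word with a stack of values and a stack of hooks

-- pushed: at the start or after an X, where no Y may be underlined; forced: a plain Y has produced only
-- the first of its two positions.
data Phase : Set where
  pushed free forced : Phase

-- sw j ≡ just i encodes a hook from position i to position j.
record Valid (n : ℕ) (val : ℕ → ℕ) (sw : ℕ → Maybe ℕ) : Set where
  field
    bounded   : ∀ {p} → p < n → val p < n
    injective : ∀ {p q} → p < n → q < n → val p ≡ val q → p ≡ q
    avoids    : ∀ {a b c} → a < b → b < c → c < n → val b < val c → val c < val a → ⊥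
    rises     : ∀ {i j} → j < n → sw j ≡ just i → i < j × val i < val j
    top       : ∀ {i j} → j < n → sw j ≡ just i → suc i < n × val (suc i) < val i
    hooked    : ∀ {i} → suc i < n → val (suc i) < val i → ∃[ j ] j < n × sw j ≡ just i
    over      : ∀ {i j l} → j < n → sw j ≡ just i → i < l → l < j → val l < val j
    uncrossed : ∀ {i j i′ j′} → j < j′ → j′ < n → sw j ≡ just i → sw j′ ≡ just i′ → i′ < i ⊎ j ≤ i′
    covered   : ∀ {p} → p < n →
      (∃[ j ] j < n × sw j ≡ just p) ⊎ (∃[ i ] sw p ≡ just i) ⊎ (∃[ o ] p ≡ suc o × val p < val o)

module _ (n : ℕ) (val : ℕ → ℕ) (sw : ℕ → Maybe ℕ) where

  -- Run t v S Q φ l: the letters l produce the positions t, t + 1, …, n − 1 when v is the next value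
  -- to enter the stack, S is the stack of values and Q the stack of SW endpoints of open hooks.
  -- An X pushes v; a Z puts v at position t and closes a hook there; an underlined Y pops S and
  -- opens a hook at t − 1; any other Y puts v at position t and then acts like an underlined Y.
  data Run : (t v : ℕ) (S Q : List ℕ) → Phase → List Label → Set where
    stop  : ∀ {v φ} → φ ≢ forced → Run n v [] [] φ []
    push  : ∀ {t v S Q φ l} → φ ≢ forced →
            Run t (suc v) (v ∷ S) Q pushed l → Run t v S Q φ ((X , false) ∷ l)
    close : ∀ {t v S q Q φ l} → φ ≢ forced → val t ≡ v → sw t ≡ just q →
            Run (suc t) (suc v) S Q free l → Run t v S (q ∷ Q) φ ((Z , false) ∷ l)
    peak  : ∀ {t v S Q φ l} → φ ≢ forced → val t ≡ v → sw t ≡ nothing →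
            Run (suc t) (suc v) S Q forced l → Run t v S Q φ ((Y , false) ∷ l)
    fall  : ∀ {t v s S Q l} → val (suc t) ≡ s → sw (suc t) ≡ nothing →
            Run (suc (suc t)) v S (t ∷ Q) free l → Run (suc t) v (s ∷ S) Q forced l
    under : ∀ {t v s S Q l} → val (suc t) ≡ s → sw (suc t) ≡ nothing →
            Run (suc (suc t)) v S (t ∷ Q) free l → Run (suc t) v (s ∷ S) Q free ((Y , true) ∷ l)

-- From runs to valid hook configurations

module _ {n : ℕ} {val : ℕ → ℕ} {sw : ℕ → Maybe ℕ} where

  run-≤ : ∀ {t v S Q φ l} → Run n val sw t v S Q φ l → t ≤ n
  run-≤ (stop _)        = ≤-refl
  run-≤ (push _ r)      = run-≤ r
  run-≤ (close _ _ _ r) = <⇒≤ (run-≤ r)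
  run-≤ (peak _ _ _ r)  = <⇒≤ (run-≤ r)
  run-≤ (fall _ _ r)    = <⇒≤ (run-≤ r)
  run-≤ (under _ _ r)   = <⇒≤ (run-≤ r)

  -- The invariant of a run before position `t`. `size` says how many values below `v` are output or
  -- waiting. `last` is what turns a pop into a descent; a push destroys it, as the pushed value
  -- exceeds every output.
  record State (t v : ℕ) (S Q : List ℕ) (φ : Phase) : Set where
    field
      below    : ∀ {p} → p < t → val p < v
      size     : t + length S ≡ v
      S-sorted : AllPairs _>_ (v ∷ S)
      unused   : All (λ s → ∀ p → p < t → val p ≢ s) S
      last     : φ ≢ pushed → ∃[ o ] t ≡ suc o × All (_< val o) S
      Q-sorted : AllPairs _>_ Q
      tops     : All (λ q → suc q < t × val (suc q) < val q) Q

  open State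

  start : State 0 0 [] [] pushed
  start = record
    { below = λ () ; size = refl ; S-sorted = [] ∷ [] ; unused = []
    ; last = contradiction refl ; Q-sorted = [] ; tops = [] }

  after-push : ∀ {t v S Q φ} → State t v S Q φ → State t (suc v) (v ∷ S) Q pushed
  after-push {t} {v} {S} st = record
    { below = m<n⇒m<1+n ∘ below st
    ; size = trans (+-suc t (length S)) (cong suc (size st))
    ; S-sorted = (≤-refl ∷ All.map m<n⇒m<1+n v>S) ∷ S-sorted st
    ; unused = (λ _ p<t → <⇒≢ (below st p<t)) ∷ unused st
    ; last = contradiction refl
    ; Q-sorted = Q-sorted st
    ; tops = tops st }
    where v>S = case S-sorted st of λ { (v>S ∷ _) → v>S }

  -- Only the hook stack changes here; the new value of a Z is accounted for by a subsequent
  -- `after-peak`.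
  after-close : ∀ {t v S q Q φ} → State t v S (q ∷ Q) φ → State t v S Q φ
  after-close st = record
    { below = below st ; size = size st ; S-sorted = S-sorted st ; unused = unused st ; last = last st
    ; Q-sorted = case Q-sorted st of λ { (_ ∷ sorted) → sorted }
    ; tops = All.tail (tops st) }

  after-peak : ∀ {t v S Q φ} φ′ → State t v S Q φ → val t ≡ v → State (suc t) (suc v) S Q φ′
  after-peak {t} {v} {S} _ st refl = record
    { below = λ p<1+t → case m≤n⇒m<n∨m≡n (s≤s⁻¹ p<1+t) of λ
        { (inj₁ p<t)  → m<n⇒m<1+n (below st p<t)
        ; (inj₂ refl) → ≤-refl }
    ; size = cong suc (size st)
    ; S-sorted = case S-sorted st of λ { (v>S ∷ sorted) → All.map m<n⇒m<1+n v>S ∷ sorted }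
    ; unused = All.zipWith (λ (s<v , ¬p) p p<1+t → case m≤n⇒m<n∨m≡n (s≤s⁻¹ p<1+t) of λ
        { (inj₁ p<t)  → ¬p p p<t
        ; (inj₂ refl) → >⇒≢ s<v }) (v>S , unused st)
    ; last = λ _ → t , refl , v>S
    ; Q-sorted = Q-sorted st
    ; tops = All.map (λ (q<t , desc) → m<n⇒m<1+n q<t , desc) (tops st) }
    where v>S = case S-sorted st of λ { (v>S ∷ _) → v>S }

  -- The last output exceeds the stack, so the pop is a descent with top `t`. By `tops`, every older
  -- open hook has its descent bottom at or before `t`, hence starts before `t`, and `Q` stays
  -- sorted.
  after-fall : ∀ {t v s S Q φ} → φ ≢ pushed → State (suc t) v (s ∷ S) Q φ → val (suc t) ≡ s →
    State (suc (suc t)) v S (t ∷ Q) free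
  after-fall {t} {v} {s} {S} φ≢ st refl
    with (s<v ∷ v>S) ∷ s>S ∷ sorted ← S-sorted st
    with _ , refl , (s<last ∷ _) ← last st φ≢ = record
    { below = λ p<2+t → case m≤n⇒m<n∨m≡n (s≤s⁻¹ p<2+t) of λ
        { (inj₁ p<1+t) → below st p<1+t
        ; (inj₂ refl)  → s<v }
    ; size = trans (cong suc (sym (+-suc t (length S)))) (size st)
    ; S-sorted = v>S ∷ sorted
    ; unused = All.zipWith (λ (r<s , ¬p) p p<2+t → case m≤n⇒m<n∨m≡n (s≤s⁻¹ p<2+t) of λ
        { (inj₁ p<1+t) → ¬p p p<1+t
        ; (inj₂ refl)  → >⇒≢ r<s }) (s>S , All.tail (unused st))
    ; last = λ _ → suc t , refl , s>S
    ; Q-sorted = All.map (λ (q<1+t , _) → s≤s⁻¹ q<1+t) (tops st) ∷ Q-sorted st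
    ; tops = (≤-refl , s<last) ∷ All.map (λ (q<t , desc) → m<n⇒m<1+n q<t , desc) (tops st) }

  -- A run localised at one position, with the states on both sides. `fall` and `under` share
  -- `falling` because they differ only in the letter consumed.
  data Event : ℕ → Set where
    closing : ∀ {t v S q Q φ l} → State t v S (q ∷ Q) φ → val t ≡ v → sw t ≡ just q →
              State (suc t) (suc v) S Q free → Run n val sw (suc t) (suc v) S Q free l → Event t
    peaking : ∀ {t v S Q φ l} → State t v S Q φ → val t ≡ v → sw t ≡ nothing →
              State (suc t) (suc v) S Q forced → Run n val sw (suc t) (suc v) S Q forced l → Event t
    falling : ∀ {t v s S Q φ l} → State (suc t) v (s ∷ S) Q φ → val (suc t) ≡ s → sw (suc t) ≡ nothing →
              State (suc (suc t)) v S (t ∷ Q) free → Run n val sw (suc (suc t)) v S (t ∷ Q) free l →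
              Event (suc t)

  event : ∀ {t v S Q φ l} → State t v S Q φ → Run n val sw t v S Q φ l → ∀ {x} → t ≤ x → x < n → Event x
  event st (stop _) t≤x x<n = contradiction x<n (≤⇒≯ t≤x)
  event st (push _ r) t≤x x<n = event (after-push st) r t≤x x<n
  event st (close _ v≡ sw≡ r) t≤x x<n with m≤n⇒m<n∨m≡n t≤x
  ... | inj₁ t<x  = event (after-peak free (after-close st) v≡) r t<x x<n
  ... | inj₂ refl = closing st v≡ sw≡ (after-peak free (after-close st) v≡) r
  event st (peak _ v≡ sw≡ r) t≤x x<n with m≤n⇒m<n∨m≡n t≤x
  ... | inj₁ t<x  = event (after-peak forced st v≡) r t<x x<n
  ... | inj₂ refl = peaking st v≡ sw≡ (after-peak forced st v≡) r
  event st (fall v≡ sw≡ r) t≤x x<n with m≤n⇒m<n∨m≡n t≤x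
  ... | inj₁ t<x  = event (after-fall (λ ()) st v≡) r t<x x<n
  ... | inj₂ refl = falling st v≡ sw≡ (after-fall (λ ()) st v≡) r
  event st (under v≡ sw≡ r) t≤x x<n with m≤n⇒m<n∨m≡n t≤x
  ... | inj₁ t<x  = event (after-fall (λ ()) st v≡) r t<x x<n
  ... | inj₂ refl = falling st v≡ sw≡ (after-fall (λ ()) st v≡) r

  -- At the end the stack is empty, so `size` forces `v` to be `n`; `below` then bounds all values
  -- by `n`.
  final : ∀ {t v S Q φ l} → State t v S Q φ → Run n val sw t v S Q φ l → ∃[ ψ ] State n n [] [] ψ
  final st (stop _) with refl ← trans (sym (+-identityʳ n)) (size st) = _ , st
  final st (push _ r)        = final (after-push st) r
  final st (close _ v≡ _ r)  = final (after-peak free (after-close st) v≡) r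
  final st (peak _ v≡ _ r)   = final (after-peak forced st v≡) r
  final st (fall v≡ _ r)     = final (after-fall (λ ()) st v≡) r
  final st (under v≡ _ r)    = final (after-fall (λ ()) st v≡) r

  value-source : ∀ {t v S Q φ l} → Run n val sw t v S Q φ l → ∀ {x} → t ≤ x → x < n → val x ∈ S ⊎ v ≤ val x
  value-source (stop _) t≤x x<n = contradiction x<n (≤⇒≯ t≤x)
  value-source (push _ r) t≤x x<n with value-source r t≤x x<n
  ... | inj₁ (here eq)  = inj₂ (≤-reflexive (sym eq))
  ... | inj₁ (there x∈) = inj₁ x∈
  ... | inj₂ v<         = inj₂ (<⇒≤ v<)
  value-source (close _ v≡ _ r) t≤x x<n with m≤n⇒m<n∨m≡n t≤x
  ... | inj₂ refl = inj₂ (≤-reflexive (sym v≡))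
  ... | inj₁ t<x with value-source r t<x x<n
  ...   | inj₁ x∈ = inj₁ x∈
  ...   | inj₂ v< = inj₂ (<⇒≤ v<)
  value-source (peak _ v≡ _ r) t≤x x<n with m≤n⇒m<n∨m≡n t≤x
  ... | inj₂ refl = inj₂ (≤-reflexive (sym v≡))
  ... | inj₁ t<x with value-source r t<x x<n
  ...   | inj₁ x∈ = inj₁ x∈
  ...   | inj₂ v< = inj₂ (<⇒≤ v<)
  value-source (fall v≡ _ r) t≤x x<n with m≤n⇒m<n∨m≡n t≤x
  ... | inj₂ refl = inj₁ (here v≡)
  ... | inj₁ t<x with value-source r t<x x<n
  ...   | inj₁ x∈ = inj₁ (there x∈)
  ...   | inj₂ v≤ = inj₂ v≤
  value-source (under v≡ _ r) t≤x x<n with m≤n⇒m<n∨m≡n t≤x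
  ... | inj₂ refl = inj₁ (here v≡)
  ... | inj₁ t<x with value-source r t<x x<n
  ...   | inj₁ x∈ = inj₁ (there x∈)
  ...   | inj₂ v≤ = inj₂ v≤

  -- The bound is `t ≤ suc i` and not `t ≤ i`: a pop at position `t` opens its hook one position
  -- earlier.
  hook-source : ∀ {t v S Q φ l} → Run n val sw t v S Q φ l →
    ∀ {i j} → t ≤ j → j < n → sw j ≡ just i → i ∈ Q ⊎ t ≤ suc i
  hook-source (stop _) t≤j j<n _ = contradiction j<n (≤⇒≯ t≤j)
  hook-source (push _ r) t≤j j<n sw≡ = hook-source r t≤j j<n sw≡
  hook-source (close _ _ sw≡q r) t≤j j<n sw≡ with m≤n⇒m<n∨m≡n t≤j
  ... | inj₂ refl = inj₁ (here (just-injective (trans (sym sw≡) sw≡q)))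
  ... | inj₁ t<j with hook-source r t<j j<n sw≡
  ...   | inj₁ i∈ = inj₁ (there i∈)
  ...   | inj₂ t< = inj₂ (<⇒≤ t<)
  hook-source (peak _ _ sw≡∅ r) t≤j j<n sw≡ with m≤n⇒m<n∨m≡n t≤j
  ... | inj₂ refl = case trans (sym sw≡) sw≡∅ of λ ()
  ... | inj₁ t<j with hook-source r t<j j<n sw≡
  ...   | inj₁ i∈ = inj₁ i∈
  ...   | inj₂ t< = inj₂ (<⇒≤ t<)
  hook-source (fall _ sw≡∅ r) t≤j j<n sw≡ with m≤n⇒m<n∨m≡n t≤j
  ... | inj₂ refl = case trans (sym sw≡) sw≡∅ of λ ()
  ... | inj₁ t<j with hook-source r t<j j<n sw≡
  ...   | inj₁ (here refl) = inj₂ ≤-refl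
  ...   | inj₁ (there i∈) = inj₁ i∈
  ...   | inj₂ t< = inj₂ (<⇒≤ t<)
  hook-source (under _ sw≡∅ r) t≤j j<n sw≡ with m≤n⇒m<n∨m≡n t≤j
  ... | inj₂ refl = case trans (sym sw≡) sw≡∅ of λ ()
  ... | inj₁ t<j with hook-source r t<j j<n sw≡
  ...   | inj₁ (here refl) = inj₂ ≤-refl
  ...   | inj₁ (there i∈) = inj₁ i∈
  ...   | inj₂ t< = inj₂ (<⇒≤ t<)

  -- A run stops only when the hook stack is empty, so every open hook gets closed.
  hook-target : ∀ {t v S Q φ l} → Run n val sw t v S Q φ l → ∀ {i} → i ∈ Q → ∃[ j ] j < n × sw j ≡ just i
  hook-target (stop _) ()
  hook-target (push _ r)          i∈          = hook-target r i∈
  hook-target (close _ _ sw≡q r)  (here refl) = _ , run-≤ r , sw≡q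
  hook-target (close _ _ _ r)     (there i∈)  = hook-target r i∈
  hook-target (peak _ _ _ r)      i∈          = hook-target r i∈
  hook-target (fall _ _ r)        i∈          = hook-target r (there i∈)
  hook-target (under _ _ r)       i∈          = hook-target r (there i∈)

  -- The bound on the values comes from the final state; every other condition is read off the event
  -- at a suitable position.
  run⇒valid : ∀ {l} → Run n val sw 0 0 [] [] pushed l → Valid n val sw
  run⇒valid run = record
    { bounded = below (proj₂ (final start run))
    ; injective = injective
    ; avoids = avoids
    ; rises = λ j<n sw≡ → let (i<j , _) , _ , i<v = hook sw≡ (at j<n) in <⇒≤ i<j , i<v
    ; top = λ j<n sw≡ → let (i<j , desc) , _ = hook sw≡ (at j<n) in <-trans i<j j<n , desc
    ; hooked = λ i<n desc → hooked (at i<n) desc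
    ; over = λ j<n sw≡ i<l l<j → let _ , up , _ = hook sw≡ (at j<n) in up l<j
    ; uncrossed = λ j<j′ j′<n sw≡ sw≡′ → uncrossed (at (<-trans j<j′ j′<n)) j<j′ j′<n sw≡ sw≡′
    ; covered = λ p<n → covered (at p<n)
    }
    where
    at : ∀ {x} → x < n → Event x
    at = event start run z≤n

    distinct : ∀ {p q} → p < q → Event q → val p ≢ val q
    distinct p<q (closing st refl _ _ _) = <⇒≢ (below st p<q)
    distinct p<q (peaking st refl _ _ _) = <⇒≢ (below st p<q)
    distinct p<q (falling st refl _ _ _) = All.head (unused st) _ p<q

    injective : ∀ {p q} → p < n → q < n → val p ≡ val q → p ≡ q
    injective {p} {q} p<n q<n eq with <-cmp p q
    ... | tri< p<q _ _ = contradiction eq (distinct p<q (at q<n))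
    ... | tri≈ _ p≡q _ = p≡q
    ... | tri> _ _ q<p = contradiction (sym eq) (distinct q<p (at p<n))

    -- A later value below `v` must come from the stack, which lies below the last output. In
    -- `avoids` the earlier and larger entry at a supplies the bound by `v`.
    descending : ∀ {b c v S Q φ l} → φ ≢ pushed → State (suc b) v S Q φ → Run n val sw (suc b) v S Q φ l →
      b < c → c < n → val c < v → val c < val b
    descending φ≢ st r b<c c<n c<v with value-source r b<c c<n
    ... | inj₂ v≤c = contradiction c<v (≤⇒≯ v≤c)
    ... | inj₁ c∈S with _ , refl , S<b ← last st φ≢ = All.lookup S<b c∈S

    avoids : ∀ {a b c} → a < b → b < c → c < n → val b < val c → val c < val a → ⊥
    avoids a<b b<c c<n b<c′ c<a with at (<-trans b<c c<n)
    ... | closing _ _ _ st r = <-asym b<c′ (descending (λ ()) st r b<c c<n (<-trans c<a (below st (m<n⇒m<1+n a<b))))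
    ... | peaking _ _ _ st r = <-asym b<c′ (descending (λ ()) st r b<c c<n (<-trans c<a (below st (m<n⇒m<1+n a<b))))
    ... | falling _ _ _ st r = <-asym b<c′ (descending (λ ()) st r b<c c<n (<-trans c<a (below st (m<n⇒m<1+n a<b))))

    hook : ∀ {i j} → sw j ≡ just i → Event j →
      (suc i < j × val (suc i) < val i) × (∀ {l} → l < j → val l < val j) × val i < val j
    hook sw≡ (closing st refl sw≡q _ _) with refl ← just-injective (trans (sym sw≡) sw≡q) =
      let (i<j , desc) = All.head (tops st) in (i<j , desc) , below st , below st (<⇒≤ i<j)
    hook sw≡ (peaking _ _ sw≡∅ _ _) = case trans (sym sw≡) sw≡∅ of λ ()
    hook sw≡ (falling _ _ sw≡∅ _ _) = case trans (sym sw≡) sw≡∅ of λ ()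

    hooked : ∀ {i} → Event (suc i) → val (suc i) < val i → ∃[ j ] j < n × sw j ≡ just i
    hooked (closing st refl _ _ _) desc = contradiction desc (<-asym (below st ≤-refl))
    hooked (peaking st refl _ _ _) desc = contradiction desc (<-asym (below st ≤-refl))
    hooked (falling _ _ _ _ r) desc = hook-target r (here refl)

    uncrossed : ∀ {i j i′ j′} → Event j → j < j′ → j′ < n →
      sw j ≡ just i → sw j′ ≡ just i′ → i′ < i ⊎ j ≤ i′
    uncrossed (closing st _ sw≡q _ r) j<j′ j′<n sw≡ sw≡′
      with refl ← just-injective (trans (sym sw≡) sw≡q)
      with q>Q ∷ _ ← Q-sorted st
      with hook-source r j<j′ j′<n sw≡′
    ... | inj₁ i′∈ = inj₁ (All.lookup q>Q i′∈)
    ... | inj₂ j≤i′ = inj₂ (s≤s⁻¹ j≤i′)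
    uncrossed (peaking _ _ sw≡∅ _ _) _ _ sw≡ _ = case trans (sym sw≡) sw≡∅ of λ ()
    uncrossed (falling _ _ sw≡∅ _ _) _ _ sw≡ _ = case trans (sym sw≡) sw≡∅ of λ ()

    covered : ∀ {p} → Event p →
      (∃[ j ] j < n × sw j ≡ just p) ⊎ (∃[ i ] sw p ≡ just i) ⊎ (∃[ o ] p ≡ suc o × val p < val o)
    covered (closing _ _ sw≡ _ _) = inj₂ (inj₁ (_ , sw≡))
    covered (falling _ refl _ st _) = inj₂ (inj₂ (_ , refl , proj₂ (All.head (tops st))))
    -- Phase `forced` leaves `fall` as the only continuation, and its descent opens a hook at the
    -- peak.
    covered (peaking _ _ _ _ (fall _ _ r)) = inj₁ (hook-target r (here refl))
    covered (peaking _ _ _ _ (stop φ≢)) = contradiction refl φ≢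
    covered (peaking _ _ _ _ (push φ≢ _)) = contradiction refl φ≢
    covered (peaking _ _ _ _ (close φ≢ _ _ _)) = contradiction refl φ≢
    covered (peaking _ _ _ _ (peak φ≢ _ _ _)) = contradiction refl φ≢

-- Words and configurations determine each other along a run

SameFrom : (t n : ℕ) (val val′ : ℕ → ℕ) (sw sw′ : ℕ → Maybe ℕ) → Set
SameFrom t n val val′ sw sw′ = ∀ {x} → t ≤ x → x < n → val x ≡ val′ x × sw x ≡ sw′ x

module _ {n : ℕ} {val val′ : ℕ → ℕ} {sw sw′ : ℕ → Maybe ℕ} where

  -- A run consults only the positions from `t` up to n - 1; earlier entries may therefore be
  -- overwritten, as `path⇒run` does.
  run-cong : ∀ {t v S Q φ l} → SameFrom t n val val′ sw sw′ →
    Run n val sw t v S Q φ l → Run n val′ sw′ t v S Q φ l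
  run-cong same (stop ok)            = stop ok
  run-cong same (push ok r)          = push ok (run-cong same r)
  run-cong same (close ok refl sw≡ r) with v≡ , s≡ ← same ≤-refl (run-≤ r) =
    close ok (sym v≡) (trans (sym s≡) sw≡) (run-cong (same ∘ <⇒≤) r)
  run-cong same (peak ok refl sw≡ r) with v≡ , s≡ ← same ≤-refl (run-≤ r) =
    peak ok (sym v≡) (trans (sym s≡) sw≡) (run-cong (same ∘ <⇒≤) r)
  run-cong same (fall refl sw≡ r) with v≡ , s≡ ← same ≤-refl (run-≤ r) =
    fall (sym v≡) (trans (sym s≡) sw≡) (run-cong (same ∘ <⇒≤) r)
  run-cong same (under refl sw≡ r) with v≡ , s≡ ← same ≤-refl (run-≤ r) =
    under (sym v≡) (trans (sym s≡) sw≡) (run-cong (same ∘ <⇒≤) r)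

  -- Each letter, together with the two stacks, prescribes `val` and `sw` at the positions it
  -- produces; the phase rules out the mixed cases.
  run-same : ∀ {t v S Q φ l} → Run n val sw t v S Q φ l → Run n val′ sw′ t v S Q φ l →
    SameFrom t n val val′ sw sw′
  run-same (stop _) _ n≤x x<n = contradiction x<n (≤⇒≯ n≤x)
  run-same (push _ r) (push _ r′) t≤x x<n = run-same r r′ t≤x x<n
  run-same (close _ v≡ s≡ r) (close _ v≡′ s≡′ r′) t≤x x<n with m≤n⇒m<n∨m≡n t≤x
  ... | inj₁ t<x  = run-same r r′ t<x x<n
  ... | inj₂ refl = trans v≡ (sym v≡′) , trans s≡ (sym s≡′)
  run-same (peak _ v≡ s≡ r) (peak _ v≡′ s≡′ r′) t≤x x<n with m≤n⇒m<n∨m≡n t≤x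
  ... | inj₁ t<x  = run-same r r′ t<x x<n
  ... | inj₂ refl = trans v≡ (sym v≡′) , trans s≡ (sym s≡′)
  run-same (fall v≡ s≡ r) (fall v≡′ s≡′ r′) t≤x x<n with m≤n⇒m<n∨m≡n t≤x
  ... | inj₁ t<x  = run-same r r′ t<x x<n
  ... | inj₂ refl = trans v≡ (sym v≡′) , trans s≡ (sym s≡′)
  run-same (fall _ _ _) (push φ≢ _) = contradiction refl φ≢
  run-same (fall _ _ _) (close φ≢ _ _ _) = contradiction refl φ≢
  run-same (fall _ _ _) (peak φ≢ _ _ _) = contradiction refl φ≢
  run-same (push φ≢ _) (fall _ _ _) = contradiction refl φ≢
  run-same (close φ≢ _ _ _) (fall _ _ _) = contradiction refl φ≢
  run-same (peak φ≢ _ _ _) (fall _ _ _) = contradiction refl φ≢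
  run-same (under v≡ s≡ r) (under v≡′ s≡′ r′) t≤x x<n with m≤n⇒m<n∨m≡n t≤x
  ... | inj₁ t<x  = run-same r r′ t<x x<n
  ... | inj₂ refl = trans v≡ (sym v≡′) , trans s≡ (sym s≡′)

module _ {n : ℕ} {val : ℕ → ℕ} {sw : ℕ → Maybe ℕ} where

  -- No pop may follow an X, so the next output is a value that has not entered the stack yet.
  pushed-≤ : ∀ {t v S Q l} → Run n val sw t v S Q pushed l → t < n → v ≤ val t
  pushed-≤ (stop _)          t<n = contradiction t<n (n≮n _)
  pushed-≤ (push _ r)        t<n = <⇒≤ (pushed-≤ r t<n)
  pushed-≤ (close _ refl _ _) _  = ≤-refl
  pushed-≤ (peak _ refl _ _) _   = ≤-refl

  run-nonempty : ∀ {t v s S Q φ l} → Run n val sw t v (s ∷ S) Q φ l → t < n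
  run-nonempty (push _ r)      = run-nonempty r
  run-nonempty (close _ _ _ r) = run-≤ r
  run-nonempty (peak _ _ _ r)  = run-≤ r
  run-nonempty (fall _ _ r)    = run-≤ r
  run-nonempty (under _ _ r)   = run-≤ r

  private
    not-pushed : ∀ {t v S Q l} → Run n val sw t (suc v) (v ∷ S) Q pushed l → ¬ (val t ≤ v)
    not-pushed r = <⇒≱ (pushed-≤ r (run-nonempty r))

  -- Outside phase `forced`, comparing `val t` with `v` reveals the letter: larger means X, smaller
  -- an underlined Y, and in the case of equality `sw t` separates Z from a plain Y.
  run-word : ∀ {t v S Q φ l l′} → All (_< v) S →
    Run n val sw t v S Q φ l → Run n val sw t v S Q φ l′ → l ≡ l′
  run-word S<v (stop _) (stop _) = refl
  run-word S<v (stop _) (push _ r) = contradiction (run-nonempty r) (n≮n _)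
  run-word S<v (stop _) (peak _ _ _ r) = contradiction (run-≤ r) (n≮n _)
  run-word S<v (push _ r) (stop _) = contradiction (run-nonempty r) (n≮n _)
  run-word S<v (push _ r) (push _ r′) = cong (_ ∷_) (run-word (≤-refl ∷ All.map m<n⇒m<1+n S<v) r r′)
  run-word S<v (push _ r) (close _ refl _ _) = contradiction ≤-refl (not-pushed r)
  run-word S<v (push _ r) (peak _ refl _ _) = contradiction ≤-refl (not-pushed r)
  run-word (s<v ∷ _) (push _ r) (under refl _ _) = contradiction (<⇒≤ s<v) (not-pushed r)
  run-word S<v (close _ refl _ _) (push _ r) = contradiction ≤-refl (not-pushed r)
  run-word S<v (close _ _ _ r) (close _ _ _ r′) = cong (_ ∷_) (run-word (All.map m<n⇒m<1+n S<v) r r′)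
  run-word S<v (close _ _ s≡ _) (peak _ _ s≡′ _) = case trans (sym s≡) s≡′ of λ ()
  run-word (s<v ∷ _) (close _ refl _ _) (under refl _ _) = contradiction s<v (n≮n _)
  run-word S<v (peak _ _ _ r) (stop _) = contradiction (run-≤ r) (n≮n _)
  run-word S<v (peak _ refl _ _) (push _ r) = contradiction ≤-refl (not-pushed r)
  run-word S<v (peak _ _ s≡ _) (close _ _ s≡′ _) = case trans (sym s≡) s≡′ of λ ()
  run-word S<v (peak _ _ _ r) (peak _ _ _ r′) = cong (_ ∷_) (run-word (All.map m<n⇒m<1+n S<v) r r′)
  run-word (s<v ∷ _) (peak _ refl _ _) (under refl _ _) = contradiction s<v (n≮n _)
  run-word (_ ∷ S<v) (fall _ _ r) (fall _ _ r′) = run-word S<v r r′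
  run-word S<v (fall _ _ _) (push φ≢ _) = contradiction refl φ≢
  run-word S<v (fall _ _ _) (peak φ≢ _ _ _) = contradiction refl φ≢
  run-word S<v (fall _ _ _) (close φ≢ _ _ _) = contradiction refl φ≢
  run-word S<v (push φ≢ _) (fall _ _ _) = contradiction refl φ≢
  run-word S<v (peak φ≢ _ _ _) (fall _ _ _) = contradiction refl φ≢
  run-word S<v (close φ≢ _ _ _) (fall _ _ _) = contradiction refl φ≢
  run-word (s<v ∷ _) (under refl _ _) (push _ r) = contradiction (<⇒≤ s<v) (not-pushed r)
  run-word (s<v ∷ _) (under refl _ _) (close _ refl _ _) = contradiction s<v (n≮n _)
  run-word (s<v ∷ _) (under refl _ _) (peak _ refl _ _) = contradiction s<v (n≮n _)
  run-word (_ ∷ S<v) (under _ _ r) (under _ _ r′) = cong (_ ∷_) (run-word S<v r r′)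

  -- `under` requires phase `free`, which only a Y or a Z leaves behind. A `peak` and the `fall`
  -- after it form one step of the path.
  run⇒path : ∀ {t v S Q φ l ℓ} → φ ≢ forced → (φ ≡ free → ℓ ≢ X) →
    Run n val sw t v S Q φ l → Path (length S) (length Q) ℓ l
  run⇒path _ bare (stop _)        = end
  run⇒path _ bare (push _ r)      = X∷ (run⇒path (λ ()) (λ ()) r)
  run⇒path _ bare (close _ _ _ r) = Z∷ (run⇒path (λ ()) (λ _ ()) r)
  run⇒path _ bare (peak _ _ _ (fall _ _ r))     = Y∷ (run⇒path (λ ()) (λ _ ()) r)
  run⇒path _ bare (peak _ _ _ (stop φ≢))        = contradiction refl φ≢
  run⇒path _ bare (peak _ _ _ (push φ≢ _))      = contradiction refl φ≢
  run⇒path _ bare (peak _ _ _ (close φ≢ _ _ _)) = contradiction refl φ≢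
  run⇒path _ bare (peak _ _ _ (peak φ≢ _ _ _))  = contradiction refl φ≢
  run⇒path φ≢ bare (fall _ _ _)   = contradiction refl φ≢
  run⇒path _ bare (under _ _ r)   = under∷ (bare refl) (run⇒path (λ ()) (λ _ ()) r)

  run-points : ∀ {t v S Q φ l} → φ ≢ forced → Run n val sw t v S Q φ l → t + points l ≡ n
  run-points _ (stop _) = +-identityʳ n
  run-points _ (push _ r) = run-points (λ ()) r
  run-points {t} _ (close _ _ _ r) = trans (+-suc t _) (run-points (λ ()) r)
  run-points {t} _ (peak _ _ _ (fall _ _ r)) = trans (+-suc t _) (trans (cong suc (+-suc t _)) (run-points (λ ()) r))
  run-points _ (peak _ _ _ (stop φ≢))        = contradiction refl φ≢
  run-points _ (peak _ _ _ (push φ≢ _))      = contradiction refl φ≢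
  run-points _ (peak _ _ _ (close φ≢ _ _ _)) = contradiction refl φ≢
  run-points _ (peak _ _ _ (peak φ≢ _ _ _))  = contradiction refl φ≢
  run-points φ≢ (fall _ _ _)   = contradiction refl φ≢
  run-points {suc t} _ (under _ _ r)   = trans (cong suc (+-suc t _)) (run-points (λ ()) r)

-- Building a run from a path

override : {A : Set} → ℕ → A → (ℕ → A) → ℕ → A
override t a f x = if does (x ≟ t) then a else f x

module _ {A : Set} (t : ℕ) (a : A) (f : ℕ → A) where

  override-at : override t a f t ≡ a
  override-at = cong (if_then a else f t) (dec-true (t ≟ t) refl)

  override-after : ∀ {x} → t < x → f x ≡ override t a f x
  override-after {x} t<x = sym (cong (if_then a else f x) (dec-false (x ≟ t) (>⇒≢ t<x)))

run-override : ∀ {n val sw t x m v S Q φ l} → Run n val sw (suc t) v S Q φ l →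
  Run n (override t x val) (override t m sw) (suc t) v S Q φ l
run-override {val = val} {sw} {t} {x} {m} =
  run-cong λ t<y _ → override-after t x val t<y , override-after t m sw t<y

-- `after-else` demands that some position has been produced: an underlined Y opens its hook there.
data AfterLetter : ℕ → Phase → Letter → Set where
  after-X    : ∀ {t} → AfterLetter t pushed X
  after-else : ∀ {t ℓ} → AfterLetter (suc t) free ℓ

unforced : ∀ {t φ ℓ} → AfterLetter t φ ℓ → φ ≢ forced
unforced after-X ()
unforced after-else ()

-- The functions are built from the end of the word: the recursive call makes them right after the
-- current letter, and `override` fills in the one or two positions of that letter.
path⇒run : ∀ {n t v s h S Q φ ℓ l} → AfterLetter t φ ℓ → Path s h ℓ l →
  s ≡ length S → h ≡ length Q → t + points l ≡ n →
  ∃[ val ] ∃[ sw ] Run n val sw t v S Q φ l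
path⇒run {t = t} {v} {S = []} {[]} after end refl refl refl =
  -- No position is left, so these default entries are never read.
  (λ _ → 0) , (λ _ → nothing) ,
  subst (λ n → Run n (λ _ → 0) (λ _ → nothing) t v [] [] _ []) (sym (+-identityʳ t)) (stop (unforced after))
path⇒run after (X∷ path) refl refl pts with val , sw , r ← path⇒run after-X path refl refl pts =
  val , sw , push (unforced after) r
path⇒run {t = t} {v} {Q = q ∷ Q} after (Z∷ path) s≡ h≡ pts
  with val , sw , r ← path⇒run after-else path s≡ (suc-injective h≡) (trans (sym (+-suc t _)) pts) =
  _ , _ , close (unforced after) (override-at t v val) (override-at t (just q) sw) (run-override r)
path⇒run {t = t} {v} {S = s ∷ S} after (Y∷ path) s≡ h≡ pts
  with val , sw , r ← path⇒run after-else path (suc-injective s≡) (cong suc h≡)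
         (trans (cong suc (sym (+-suc t _))) (trans (sym (+-suc t _)) pts)) =
  let val′ = override (suc t) s val; sw′ = override (suc t) nothing sw in
  _ , _ , peak (unforced after) (override-at t v val′) (override-at t nothing sw′)
    (run-override (fall (override-at (suc t) s val) (override-at (suc t) nothing sw) (run-override r)))
path⇒run after-X (under∷ X≢X _) _ _ _ = contradiction refl X≢X
path⇒run {t = suc t} {S = s ∷ S} after-else (under∷ _ path) s≡ h≡ pts
  with val , sw , r ← path⇒run after-else path (suc-injective s≡) (cong suc h≡) (trans (sym (+-suc (suc t) _)) pts) =
  _ , _ , under (override-at (suc t) s val) (override-at (suc t) nothing sw) (run-override r)

-- Recovering a run from a valid hook configuration

module _ {n : ℕ} {val : ℕ → ℕ} {sw : ℕ → Maybe ℕ} (valid : Valid n val sw)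
         (surjective : ∀ {x} → x < n → ∃[ p ] p < n × val p ≡ x) where

  open Valid valid
  open State

  -- `opened` and `pending`, with `tops` of the state, make `Q` exactly the set of SW endpoints
  -- whose descent has been read and whose NE endpoint is still to come. `descending` guarantees the
  -- pop that a plain Y owes.
  record Reached (t v : ℕ) (S Q : List ℕ) (φ : Phase) : Set where
    field
      state      : State {n} {val} {sw} t v S Q φ
      bound      : v ≤ n
      emitted    : ∀ {x} → x < v → (∃[ p ] p < t × val p ≡ x) ⊎ x ∈ S
      opened     : ∀ {i j} → suc i < t → t ≤ j → j < n → sw j ≡ just i → i ∈ Q
      pending    : All (λ q → ∃[ j ] t ≤ j × j < n × sw j ≡ just q) Q
      descending : φ ≡ forced → ∃[ o ] t ≡ suc o × t < n × val t < val o

  open Reached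

  -- At the boundary between two positions the last left-to-right maximum is v − 1.
  Maximum : (t v : ℕ) (φ : Phase) → Set
  Maximum t v φ = v ≡ 0 ⊎ (φ ≢ pushed × ∃[ a ] a < t × suc (val a) ≡ v)

  module _ {t v S Q φ} (r : Reached t v S Q φ) (t<n : t < n) where

    pending-after : (∀ {q} → q ∈ Q → sw t ≢ just q) → All (λ q → ∃[ j ] t < j × j < n × sw j ≡ just q) Q
    pending-after elsewhere = All.tabulate λ q∈ → case All.lookup (pending r) q∈ of λ
      { (j , t≤j , j<n , sw≡) → j , ≤∧≢⇒< t≤j (λ { refl → elsewhere q∈ sw≡ }) , j<n , sw≡ }

    not-forced : v ≤ val t → φ ≢ forced
    not-forced v≤ refl with o , refl , _ , desc ← descending r refl =
      <⇒≱ (<-trans desc (below (state r) ≤-refl)) v≤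

    reached-push : v < n → Reached t (suc v) (v ∷ S) Q pushed
    reached-push v<n = record
      { state = after-push (state r)
      ; bound = v<n
      ; emitted = λ x<1+v → case m≤n⇒m<n∨m≡n (s≤s⁻¹ x<1+v) of λ
          { (inj₂ refl) → inj₂ (here refl)
          ; (inj₁ x<v) → case emitted r x<v of λ
            { (inj₁ before) → inj₁ before
            ; (inj₂ x∈S)    → inj₂ (there x∈S) } }
      ; opened = opened r
      ; pending = pending r
      ; descending = λ () }

    module _ (v≡ : val t ≡ v) where

      emitted-peak : ∀ {x} → x < suc v → (∃[ p ] p < suc t × val p ≡ x) ⊎ x ∈ S
      emitted-peak x<1+v with m≤n⇒m<n∨m≡n (s≤s⁻¹ x<1+v)
      ... | inj₂ refl = inj₁ (t , ≤-refl , v≡)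
      ... | inj₁ x<v with emitted r x<v
      ...   | inj₁ (p , p<t , eq) = inj₁ (p , m<n⇒m<1+n p<t , eq)
      ...   | inj₂ x∈S            = inj₂ x∈S

      bound-peak : suc v ≤ n
      bound-peak = subst (_< n) v≡ (bounded t<n)

      not-bottom : ∀ {o} → t ≡ suc o → ¬ (val t < val o)
      not-bottom refl desc = <-asym (subst (val _ <_) (sym v≡) (below (state r) ≤-refl)) desc

      opened-peak : ∀ {i j} → suc i < suc t → suc t ≤ j → j < n → sw j ≡ just i → i ∈ Q
      opened-peak 1+i<1+t t<j j<n sw≡ with m≤n⇒m<n∨m≡n (s≤s⁻¹ 1+i<1+t)
      ... | inj₁ 1+i<t = opened r 1+i<t (<⇒≤ t<j) j<n sw≡
      ... | inj₂ refl  = contradiction (proj₂ (top j<n sw≡)) (not-bottom refl)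

      reached-peak : sw t ≡ nothing → Reached (suc t) (suc v) S Q forced
      reached-peak sw≡∅ = record
        { state = after-peak forced (state r) v≡
        ; bound = bound-peak
        ; emitted = emitted-peak
        ; opened = opened-peak
        ; pending = pending-after λ _ sw≡ → case trans (sym sw≡) sw≡∅ of λ ()
        -- Reducedness enters here: a new maximum is no descent bottom, so without a NE endpoint it
        -- must be a SW endpoint, and thus a descent top.
        ; descending = λ _ → t , refl , (case covered t<n of λ
            { (inj₁ (j , j<n , sw≡))        → top j<n sw≡
            ; (inj₂ (inj₁ (i , sw≡)))       → case trans (sym sw≡) sw≡∅ of λ ()
            ; (inj₂ (inj₂ (o , t≡ , desc))) → contradiction desc (not-bottom t≡) }) }

      closes-last : ∀ {q} → sw t ≡ just q → ∃[ Q′ ] Q ≡ q ∷ Q′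
      closes-last {q} sw≡ = last′ (opened r 1+q<t ≤-refl t<n sw≡) (Q-sorted (state r)) (tops (state r)) (pending r)
        where
        -- A hook to the adjacent position would end at a descent bottom, which the new maximum at
        -- `t` is not.
        1+q<t : suc q < t
        1+q<t = ≤∧≢⇒< (proj₁ (rises t<n sw≡)) λ { refl → not-bottom refl (proj₂ (top t<n sw≡)) }

        -- A later open hook q₀ would cross the hook from q to t.
        last′ : ∀ {Q} → q ∈ Q → AllPairs _>_ Q → All (λ q → suc q < t × val (suc q) < val q) Q →
          All (λ q → ∃[ j ] t ≤ j × j < n × sw j ≡ just q) Q → ∃[ Q′ ] Q ≡ q ∷ Q′
        last′ (here refl) _ _ _ = _ , refl
        last′ (there q∈) (q₀>Q ∷ _) ((q₀<t , _) ∷ _) ((j , t≤j , j<n , sw≡₀) ∷ _)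
          with m≤n⇒m<n∨m≡n t≤j
        ... | inj₂ refl = contradiction (just-injective (trans (sym sw≡) sw≡₀)) (<⇒≢ (All.lookup q₀>Q q∈))
        ... | inj₁ t<j with uncrossed t<j j<n sw≡ sw≡₀
        ...   | inj₁ q₀<q = contradiction q₀<q (<-asym (All.lookup q₀>Q q∈))
        ...   | inj₂ t≤q₀ = contradiction (<⇒≤ q₀<t) (≤⇒≯ t≤q₀)

  reached-close : ∀ {t v S q Q φ} → Reached t v S (q ∷ Q) φ → t < n → val t ≡ v → sw t ≡ just q →
    Reached (suc t) (suc v) S Q free
  reached-close {t} {q = q} r t<n v≡ sw≡ = record
    { state = after-peak free (after-close (state r)) v≡
    ; bound = bound-peak r t<n v≡
    ; emitted = emitted-peak r t<n v≡
    ; opened = λ 1+i<1+t t<j j<n sw≡′ → case opened-peak r t<n v≡ 1+i<1+t t<j j<n sw≡′ of λ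
        { (there i∈) → i∈
        -- Here two hooks would start at `q`, and `uncrossed` fails for them.
        ; (here refl) → case uncrossed t<j j<n sw≡ sw≡′ of λ
          { (inj₁ q<q) → contradiction q<q (n≮n q)
          ; (inj₂ t≤q) → contradiction t≤q (<⇒≱ (proj₁ (rises t<n sw≡))) } }
    ; pending = All.tabulate λ q∈ → case All.lookup (pending r) (there q∈) of λ
      { (j , t≤j , j<n , sw≡′) → j , ≤∧≢⇒< t≤j (λ { refl → case Q-sorted (state r) of λ
          { (q>Q ∷ _) → <⇒≢ (All.lookup q>Q q∈) (just-injective (trans (sym sw≡′) sw≡)) } }) , j<n , sw≡′ }
    ; descending = λ () }

  module _ {t v S Q φ} (r : Reached t v S Q φ) (t<n : t < n) (t<v : val t < v) where

    falls-to-top : φ ≢ pushed × (∃[ a ] a < t × suc (val a) ≡ v) → ∃[ S′ ] S ≡ val t ∷ S′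
    falls-to-top (_ , a , a<t , a≡) with emitted r t<v
    ... | inj₁ (p , p<t , eq) = contradiction (injective (<-trans p<t t<n) t<n eq) (<⇒≢ p<t)
    ... | inj₂ t∈S = top′ t∈S (S-sorted (state r)) (unused (state r))
      where
      -- A value s above val t in S occurs after t; with v − 1 before t it would form a 312.
      top′ : ∀ {S} → val t ∈ S → AllPairs _>_ (v ∷ S) → All (λ s → ∀ p → p < t → val p ≢ s) S →
        ∃[ S′ ] S ≡ val t ∷ S′
      top′ (here refl) _ _ = _ , refl
      top′ {s ∷ _} (there t∈) ((s<v ∷ _) ∷ s>S ∷ _) (s-unused ∷ _)
        with c , c<n , refl ← surjective (≤-trans s<v (bound r)) =
        contradiction c<a (avoids a<t t<c c<n t<c′)
        where
        t<c′ : val t < val c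
        t<c′ = All.lookup s>S t∈

        t<c : t < c
        t<c with <-cmp t c
        ... | tri< t<c _ _ = t<c
        ... | tri≈ _ refl _ = contradiction t<c′ (n≮n _)
        ... | tri> _ _ c<t = contradiction refl (s-unused c c<t)

        c<a : val c < val a
        c<a = ≤∧≢⇒< (s≤s⁻¹ (subst (val c <_) (sym a≡) s<v)) (λ eq → s-unused a a<t (sym eq))

  reached-fall : ∀ {t v S Q φ} → φ ≢ pushed → Reached (suc t) v (val (suc t) ∷ S) Q φ → suc t < n →
    sw (suc t) ≡ nothing × Reached (suc (suc t)) v S (t ∷ Q) free
  reached-fall {t} {v} {S} {Q} φ≢ r t<n with _ , refl , (desc ∷ _) ← last (state r) φ≢ = sw≡∅ , record
    { state = after-fall φ≢ (state r) refl
    ; bound = bound r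
    ; emitted = emitted′
    ; opened = opened′
    ; pending = (case hooked t<n desc of λ
        { (j , j<n , sw≡) → j , ≤∧≢⇒< (proj₁ (rises j<n sw≡)) (λ { refl → none sw≡ }) , j<n , sw≡ })
        ∷ pending-after r t<n (λ _ → none)
    ; descending = λ () }
    where
    -- A descent bottom ends no hook: a hook from `t` would have to rise, and one from further left
    -- would have the point at `t` above it.
    sw≡∅ : sw (suc t) ≡ nothing
    sw≡∅ with sw (suc t) in eq
    ... | nothing = refl
    ... | just i with rises t<n eq
    ...   | i<1+t , i<t′ with m≤n⇒m<n∨m≡n (s≤s⁻¹ i<1+t)
    ...     | inj₂ refl = contradiction i<t′ (<-asym desc)
    ...     | inj₁ i<t  = contradiction (over t<n eq i<t ≤-refl) (<-asym desc)

    none : ∀ {q} → sw (suc t) ≢ just q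
    none sw≡ = case trans (sym sw≡) sw≡∅ of λ ()

    emitted′ : ∀ {x} → x < v → (∃[ p ] p < suc (suc t) × val p ≡ x) ⊎ x ∈ S
    emitted′ x<v with emitted r x<v
    ... | inj₁ (p , p<t , eq) = inj₁ (p , m<n⇒m<1+n p<t , eq)
    ... | inj₂ (here refl)    = inj₁ (suc t , ≤-refl , refl)
    ... | inj₂ (there x∈)     = inj₂ x∈

    opened′ : ∀ {i j} → suc i < suc (suc t) → suc (suc t) ≤ j → j < n → sw j ≡ just i → i ∈ t ∷ Q
    opened′ 1+i<2+t t<j j<n sw≡ with m≤n⇒m<n∨m≡n (s≤s⁻¹ 1+i<2+t)
    ... | inj₁ 1+i<1+t = there (opened r 1+i<1+t (<⇒≤ t<j) j<n sw≡)
    ... | inj₂ refl    = here refl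

  -- Recursion on the number `d` of positions left. If `val t` is at least `v`, it is a new maximum
  -- and comes after some pushes; otherwise it is the top of the stack and is popped.
  reached⇒run : ∀ d {t v S Q φ} → t + d ≡ n → Reached t v S Q φ → Maximum t v φ →
    ∃[ l ] Run n val sw t v S Q φ l
  -- `e` is the number of X's still to be read before the output at position `t`.
  reached⇒run-pushed : ∀ d e {t v S Q φ} → suc t + d ≡ n → e + v ≡ val t → Reached t v S Q φ →
    ∃[ l ] Run n val sw t v S Q φ l

  reached⇒run zero {t} {v} {S} {Q} {φ} t≡n r _ with refl ← trans (sym (+-identityʳ t)) t≡n =
    done S Q r
    where
    done : ∀ S Q → Reached n v S Q φ → ∃[ l ] Run n val sw n v S Q φ l
    -- A value left on the stack would push `v` beyond `n` by `size`; a hook left open would need a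
    -- NE endpoint beyond the last position.
    done (s ∷ S) Q r = contradiction
      (≤-trans (≤-reflexive (trans (sym (+-suc n _)) (size (state r)))) (bound r)) (<⇒≱ (s≤s (m≤m+n n _)))
    done [] (q ∷ Q) r with (j , n≤j , j<n , _) ∷ _ ← pending r = contradiction j<n (≤⇒≯ n≤j)
    done [] [] r = [] , stop λ { refl → case descending r refl of λ { (_ , _ , n<n , _) → n≮n n n<n } }
  reached⇒run (suc d) {t} {v} {S} {φ = φ} t+d≡n r max with v ≤? val t
  ... | yes v≤ = reached⇒run-pushed d (val t ∸ v) (trans (sym (+-suc t d)) t+d≡n) (m∸n+n≡m v≤) r
  ... | no v≰ with max
  ...   | inj₁ refl = contradiction z≤n v≰
  ...   | inj₂ m@(φ≢ , a , a<t , a≡)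
          with falls-to-top r t<n (≰⇒> v≰) m | last (state r) φ≢
          where t<n = ≤-trans (s≤s (m≤m+n t d)) (≤-reflexive (trans (sym (+-suc t d)) t+d≡n))
  ...     | S′ , refl | o , refl , _ = falling-run φ refl
    where
    1+t+d≡n = trans (sym (+-suc t d)) t+d≡n
    t<n = ≤-trans (s≤s (m≤m+n t d)) (≤-reflexive 1+t+d≡n)

    rest = reached-fall φ≢ r t<n
    tail-run = reached⇒run d 1+t+d≡n (proj₂ rest) (inj₂ ((λ ()) , a , m<n⇒m<1+n a<t , a≡))

    falling-run : ∀ ψ → ψ ≡ φ → ∃[ l ] Run n val sw (suc o) v (val (suc o) ∷ S′) _ ψ l
    falling-run pushed refl = contradiction refl φ≢
    falling-run free   refl = _ , under refl (proj₁ rest) (proj₂ tail-run)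
    falling-run forced refl = _ , fall refl (proj₁ rest) (proj₂ tail-run)

  reached⇒run-pushed d (suc e) {t} {v} t+d≡n e+v≡ r =
    let t<n = ≤-trans (s≤s (m≤m+n t d)) (≤-reflexive t+d≡n)
        v<t = ≤-trans (s≤s (m≤n+m v e)) (≤-reflexive e+v≡)
        _ , run = reached⇒run-pushed d e t+d≡n (trans (+-suc e v) e+v≡)
                    (reached-push r t<n (<-trans v<t (bounded t<n)))
    in _ , push (not-forced r t<n (<⇒≤ v<t)) run
  reached⇒run-pushed d zero {t} {v} {S} {Q} t+d≡n v≡ r with sw t in eq
  ... | nothing =
    let _ , run = reached⇒run d t+d≡n (reached-peak r t<n (sym v≡) eq)
                    (inj₂ ((λ ()) , t , ≤-refl , cong suc (sym v≡)))
    in _ , peak (not-forced r t<n (≤-reflexive v≡)) (sym v≡) eq run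
    where t<n = ≤-trans (s≤s (m≤m+n t d)) (≤-reflexive t+d≡n)
  ... | just q with closes-last r (≤-trans (s≤s (m≤m+n t d)) (≤-reflexive t+d≡n)) (sym v≡) eq
  ...   | _ , refl =
    let _ , run = reached⇒run d t+d≡n (reached-close r t<n (sym v≡) eq)
                    (inj₂ ((λ ()) , t , ≤-refl , cong suc (sym v≡)))
    in _ , close (not-forced r t<n (≤-reflexive v≡)) (sym v≡) eq run
    where t<n = ≤-trans (s≤s (m≤m+n t d)) (≤-reflexive t+d≡n)

  valid⇒run : ∃[ l ] Run n val sw 0 0 [] [] pushed l
  valid⇒run = reached⇒run n refl record
    { state = start ; bound = z≤n ; emitted = λ () ; opened = λ () ; pending = [] ; descending = λ () }
    (inj₁ refl)

-- Configurations

-- Punching out a missed value would leave an injection into a smaller set.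
injective⇒surjective : ∀ {n} (f : Fin n → Fin n) → (∀ {i j} → f i ≡ f j → i ≡ j) → ∀ y → ∃[ x ] f x ≡ y
injective⇒surjective {suc n} f inj y with Fin.any? (λ x → f x Fin.≟ y)
... | yes hit = hit
... | no miss = contradiction
  (Fin.injective⇒≤ {f = λ x → punchOut {i = y} (λ y≡ → miss (x , sym y≡))}
    (λ {i} {j} eq → inj (Fin.punchOut-injective (λ y≡ → miss (i , sym y≡)) (λ y≡ → miss (j , sym y≡)) eq)))
  (n≮n n)

fin : ∀ {n p} → p < n → ∃[ i ] toℕ {n} i ≡ p
fin p<n = fromℕ< p<n , Fin.toℕ-fromℕ< p<n

-- As `sw` is a function of the NE endpoint, `hook⁺` implies that no two hooks share one. Nothing is
-- said about positions from `n` on.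
record Represents {n} (val : ℕ → ℕ) (sw : ℕ → Maybe ℕ) (π : OneLine n) (H : HookSet n) : Set where
  field
    value : ∀ i → val (toℕ i) ≡ toℕ (lookup π i)
    hook⁺ : ∀ {i j} → (i , j) ∈ʰ H → sw (toℕ j) ≡ just (toℕ i)
    hook⁻ : ∀ {i j} → sw (toℕ j) ≡ just (toℕ i) → (i , j) ∈ʰ H
    sw<   : ∀ {q} j → sw (toℕ j) ≡ just q → q < n

  value⁺ : ∀ {i j} → lookup π i <ᶠ lookup π j → val (toℕ i) < val (toℕ j)
  value⁺ {i} {j} = subst₂ _<_ (sym (value i)) (sym (value j))

  value⁻ : ∀ {i j} → val (toℕ i) < val (toℕ j) → lookup π i <ᶠ lookup π j
  value⁻ {i} {j} = subst₂ _<_ (value i) (value j)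

  hookAt : ∀ {i j} → j < n → sw j ≡ just i →
    ∃[ i′ ] ∃[ j′ ] toℕ i′ ≡ i × toℕ j′ ≡ j × (i′ , j′) ∈ʰ H
  hookAt j<n sw≡ with j′ , refl ← fin j<n with i′ , refl ← fin (sw< j′ sw≡) =
    i′ , j′ , refl , refl , hook⁻ sw≡

-- Counting hooks

sum-zero : ∀ {n} (f : Fin n → ℕ) → (∀ i → f i ≡ 0) → sum f ≡ 0
sum-zero {n} f f≡0 = trans (sum-cong-≗ f≡0) (sum-replicate-zero n)

sum-single : ∀ {n} (f : Fin n → ℕ) i → (∀ j → j ≢ i → f j ≡ 0) → sum f ≡ f i
sum-single f zero    f≡0 = trans (cong (f zero +_) (sum-zero (f ∘ suc) (λ j → f≡0 (suc j) λ ()))) (+-identityʳ _)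
sum-single f (suc i) f≡0 = cong₂ _+_ (f≡0 zero λ ()) (sum-single (f ∘ suc) i (λ j j≢ → f≡0 (suc j) (j≢ ∘ Fin.suc-injective)))

bit : Bool → ℕ
bit b = if b then 1 else 0

∣U∣≡sum : ∀ {n} (U : Subset n) → ∣ U ∣ ≡ sum (bit ∘ lookup U)
∣U∣≡sum []          = refl
∣U∣≡sum (true ∷ U)  = cong suc (∣U∣≡sum U)
∣U∣≡sum (false ∷ U) = ∣U∣≡sum U

sum-map : ∀ {A : Set} {n} (f : A → ℕ) (v : Vec A n) → Vec.sum (Vec.map f v) ≡ sum (f ∘ lookup v)
sum-map f []      = refl
sum-map f (a ∷ v) = cong (f a +_) (sum-map f v)

closed : Maybe ℕ → ℕ
closed (just _) = 1
closed nothing  = 0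

-- Summing over columns instead of rows counts NE endpoints instead of SW endpoints.
hookCount≡ : ∀ {n val sw} {π : OneLine n} {H} → Represents val sw π H →
  hookCount H ≡ sum {n} (closed ∘ sw ∘ toℕ)
hookCount≡ {n} {sw = sw} {H = H} rep = begin
  hookCount H
    ≡⟨ sum-map ∣_∣ H ⟩
  sum (λ i → ∣ lookup H i ∣)
    ≡⟨ sum-cong-≗ (λ i → ∣U∣≡sum (lookup H i)) ⟩
  sum (λ i → sum (λ j → bit (lookup (lookup H i) j)))
    ≡⟨ ∑-comm (λ i j → bit (lookup (lookup H i) j)) ⟩
  sum column
    ≡⟨ sum-cong-≗ {n} {column} {closed ∘ sw ∘ toℕ} column≡ ⟩
  sum {n} (closed ∘ sw ∘ toℕ) ∎
  where
  open ≡-Reasoning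
  open Represents rep

  column : Fin n → ℕ
  column j = sum λ i → bit (lookup (lookup H i) j)

  absent : ∀ i j → sw (toℕ j) ≢ just (toℕ i) → bit (lookup (lookup H i) j) ≡ 0
  absent i j sw≢ with lookup (lookup H i) j in eq
  ... | false = refl
  ... | true  = contradiction (hook⁺ (Vec.lookup⇒[]= j (lookup H i) eq)) sw≢

  column≡ : ∀ j → column j ≡ closed (sw (toℕ j))
  column≡ j with sw (toℕ j) in eq
  ... | nothing = sum-zero _ (λ i → absent i j λ sw≡ → case trans (sym sw≡) eq of λ ())
  ... | just q with i , refl ← fin (sw< j eq) = trans
    (sum-single (λ i → bit (lookup (lookup H i) j)) i (λ i′ i′≢i → absent i′ j λ sw≡ →
      i′≢i (Fin.toℕ-injective (just-injective (trans (sym sw≡) eq)))))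
    (cong bit (Vec.[]=⇒lookup (hook⁻ eq)))

-- Recursion from the left, so that each step of a run peels off its own position.
closures : (ℕ → Maybe ℕ) → (t d : ℕ) → ℕ
closures sw t zero    = 0
closures sw t (suc d) = closed (sw t) + closures sw (suc t) d

sum≡closures : ∀ sw t n → sum {n} (λ j → closed (sw (t + toℕ j))) ≡ closures sw t n
sum≡closures sw t zero    = refl
sum≡closures sw t (suc n) = cong₂ _+_ (cong (closed ∘ sw) (+-identityʳ t))
  (trans (sum-cong-≗ {n} (λ j → cong (closed ∘ sw) (+-suc t (toℕ j)))) (sum≡closures sw (suc t) n))

module _ {n : ℕ} {val : ℕ → ℕ} {sw : ℕ → Maybe ℕ} where

  private
    one-position : ∀ {t} d → t < n → t + d ≡ n → ∃[ d′ ] d ≡ suc d′ × suc t + d′ ≡ n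
    one-position {t} zero    t<n t≡n   = contradiction t<n (≤⇒≯ (≤-reflexive (trans (sym t≡n) (+-identityʳ t))))
    one-position {t} (suc d) t<n t+d≡n = d , refl , trans (sym (+-suc t d)) t+d≡n

  -- Z is the only letter that sets a NE endpoint; the positions produced by a Y have none.
  run-closures : ∀ {t v S Q φ l} d → t + d ≡ n → Run n val sw t v S Q φ l →
    closures sw t d ≡ occurrences Z (map proj₁ l)
  run-closures zero    _     (stop _) = refl
  run-closures (suc d) n+d≡n (stop _) = contradiction n+d≡n (m+1+n≢m n)
  run-closures d t+d≡n (push _ r) = run-closures d t+d≡n r
  run-closures d t+d≡n (close _ _ sw≡ r) with d′ , refl , eq ← one-position d (run-≤ r) t+d≡n
    rewrite sw≡ = cong suc (run-closures d′ eq r)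
  run-closures d t+d≡n (peak _ _ sw≡ r) with d′ , refl , eq ← one-position d (run-≤ r) t+d≡n
    rewrite sw≡ = run-closures d′ eq r
  run-closures d t+d≡n (fall _ sw≡ r) with d′ , refl , eq ← one-position d (run-≤ r) t+d≡n
    rewrite sw≡ = run-closures d′ eq r
  run-closures d t+d≡n (under _ sw≡ r) with d′ , refl , eq ← one-position d (run-≤ r) t+d≡n
    rewrite sw≡ = run-closures d′ eq r

  hookCount≡occurrences : ∀ {π : OneLine n} {H l} → Represents val sw π H →
    Run n val sw 0 0 [] [] pushed l → hookCount H ≡ occurrences Z (map proj₁ l)
  hookCount≡occurrences rep run =
    trans (hookCount≡ rep) (trans (sum≡closures sw 0 n) (run-closures n refl run))

-- Passing between hook configurations and functions on the naturals

extend : ∀ {A : Set} {n} → A → (Fin n → A) → ℕ → A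
extend {n = n} a f x with x <? n
... | yes x<n = f (fromℕ< x<n)
... | no _    = a

extend-toℕ : ∀ {A : Set} {n} (a : A) (f : Fin n → A) i → extend a f (toℕ i) ≡ f i
extend-toℕ {n = n} a f i with toℕ i <? n
... | yes i<n = cong f (Fin.fromℕ<-toℕ i i<n)
... | no i≮n  = contradiction (Fin.toℕ<n i) i≮n

module _ {n : ℕ} {π : OneLine n} {H : HookSet n} (perm : IsPermutation π) (vhc : IsVHC π H) where

  open IsVHC vhc

  private
    π-not-over : ∀ {i j l} → (i , j) ∈ʰ H → i <ᶠ l → l <ᶠ j → lookup π l <ᶠ lookup π j
    π-not-over {i} {j} {l} h i<l l<j = ≤∧≢⇒< (≮⇒≥ λ j<l → nothingOver i j h (l , i<l , l<j , j<l))
      (λ eq → <⇒≢ l<j (cong toℕ (perm (Fin.toℕ-injective eq))))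

    -- The hooks would meet at (i′ , π j), which is not an endpoint of the first.
    no-crossing : ∀ {i j i′ j′} → (i , j) ∈ʰ H → (i′ , j′) ∈ʰ H → (i , j) ≢ (i′ , j′) →
      i <ᶠ i′ → i′ <ᶠ j → ¬ (lookup π j ≤ᶠ lookup π j′)
    no-crossing {i} {j} {i′} {j′} h h′ distinct i<i′ i′<j j≤j′
      with proj₁ (noCrossing i j i′ j′ h h′ distinct i′ (lookup π j) (inj₂ (refl , <⇒≤ i<i′ , <⇒≤ i′<j))
                   (inj₁ (refl , <⇒≤ (π-not-over h i<i′ i′<j) , j≤j′)))
    ... | inj₁ eq = contradiction i<i′ (≤⇒≯ (≤-reflexive (cong (toℕ ∘ proj₁) eq)))
    ... | inj₂ eq = contradiction (cong (toℕ ∘ proj₁) eq) (<⇒≢ i′<j)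

    -- Hooks with a common NE endpoint overlap horizontally: the case of equal heights in
    -- `no-crossing`.
    column-unique : ∀ {i i′ j} → (i , j) ∈ʰ H → (i′ , j) ∈ʰ H → i ≡ i′
    column-unique {i} {i′} {j} h h′ with <-cmp (toℕ i) (toℕ i′)
    ... | tri≈ _ eq _ = Fin.toℕ-injective eq
    ... | tri< i<i′ _ _ = contradiction ≤-refl
      (no-crossing h h′ (λ { refl → n≮n _ i<i′ }) i<i′ (proj₁ (hooks i′ j h′)))
    ... | tri> _ _ i′<i = contradiction ≤-refl
      (no-crossing h′ h (λ { refl → n≮n _ i′<i }) i′<i (proj₁ (hooks i j h)))

    endpoint : Fin n → Maybe ℕ
    endpoint j with Fin.any? (λ i → j Subset.∈? lookup H i)
    ... | yes (i , _) = just (toℕ i)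
    ... | no _        = nothing

    endpoint⁺ : ∀ {i j} → (i , j) ∈ʰ H → endpoint j ≡ just (toℕ i)
    endpoint⁺ {i} {j} h with Fin.any? (λ i → j Subset.∈? lookup H i)
    ... | yes (i′ , h′) = cong (just ∘ toℕ) (column-unique h′ h)
    ... | no none       = contradiction (i , h) none

    endpoint⁻ : ∀ {q} j → endpoint j ≡ just q → ∃[ i ] q ≡ toℕ i × (i , j) ∈ʰ H
    endpoint⁻ j eq with Fin.any? (λ i → j Subset.∈? lookup H i)
    endpoint⁻ j refl | yes (i , h) = i , refl , h

  represent : ∃[ val ] ∃[ sw ] Represents val sw π H
  represent = extend 0 (toℕ ∘ lookup π) , extend nothing endpoint , record
    { value = extend-toℕ 0 (toℕ ∘ lookup π)
    ; hook⁺ = λ {i} {j} h → trans (extend-toℕ nothing endpoint j) (endpoint⁺ h)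
    ; hook⁻ = λ {i} {j} eq → case endpoint⁻ j (trans (sym (extend-toℕ nothing endpoint j)) eq) of λ
        { (i′ , i≡ , h) → subst (λ i → (i , j) ∈ʰ H) (sym (Fin.toℕ-injective i≡)) h }
    ; sw< = λ j eq → case endpoint⁻ j (trans (sym (extend-toℕ nothing endpoint j)) eq) of λ
        { (i , refl , _) → Fin.toℕ<n i } }

  module _ {val sw} (avoids : Avoids312 π) (reduced : IsReduced π H) (rep : Represents val sw π H) where

    open Represents rep

    represents⇒valid : Valid n val sw
    represents⇒valid = record
      { bounded = bounded ; injective = injective ; avoids = avoids′ ; rises = rises ; top = top
      ; hooked = hooked ; over = over ; uncrossed = uncrossed ; covered = covered }
      where
      bounded : ∀ {p} → p < n → val p < n
      bounded p<n with i , refl ← fin p<n = subst (_< n) (sym (value i)) (Fin.toℕ<n (lookup π i))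

      injective : ∀ {p q} → p < n → q < n → val p ≡ val q → p ≡ q
      injective p<n q<n eq with i , refl ← fin p<n with j , refl ← fin q<n =
        cong toℕ (perm (Fin.toℕ-injective (trans (sym (value i)) (trans eq (value j)))))

      avoids′ : ∀ {a b c} → a < b → b < c → c < n → val b < val c → val c < val a → ⊥
      avoids′ a<b b<c c<n b<c′ c<a
        with c , refl ← fin c<n
        with b , refl ← fin (<-trans b<c c<n)
        with a , refl ← fin (<-trans a<b (<-trans b<c c<n)) =
        avoids a b c a<b b<c (value⁻ b<c′ , value⁻ c<a)

      rises : ∀ {i j} → j < n → sw j ≡ just i → i < j × val i < val j
      rises j<n sw≡ with i , j , refl , refl , h ← hookAt j<n sw≡ =
        proj₁ (hooks i j h) , value⁺ (proj₂ (hooks i j h))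

      top : ∀ {i j} → j < n → sw j ≡ just i → suc i < n × val (suc i) < val i
      top j<n sw≡ with i , j , refl , refl , h ← hookAt j<n sw≡
        with o , i⋖o , desc ← Equivalence.to (sw⇔top i) (j , h) =
        subst (λ x → x < n × val x < val (toℕ i)) i⋖o (Fin.toℕ<n o , value⁺ desc)

      hooked : ∀ {i} → suc i < n → val (suc i) < val i → ∃[ j ] j < n × sw j ≡ just i
      hooked 1+i<n desc with o , eq ← fin 1+i<n with i , refl ← fin (<⇒≤ 1+i<n)
        with j , h ← Equivalence.from (sw⇔top i) (o , eq , value⁻ (subst (λ x → val x < val (toℕ i)) (sym eq) desc)) =
        toℕ j , Fin.toℕ<n j , hook⁺ h

      over : ∀ {i j l} → j < n → sw j ≡ just i → i < l → l < j → val l < val j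
      over j<n sw≡ i<l l<j with i , j , refl , refl , h ← hookAt j<n sw≡
        with l , refl ← fin (<-trans l<j j<n) = value⁺ (π-not-over h i<l l<j)

      -- Otherwise i ≤ i′ < j < j′, and the point at j lies below the second hook. If i < i′, the
      -- hooks cross. If i and i′ agree, the second hook passes through the corner of the first,
      -- which is no endpoint.
      uncrossed : ∀ {i j i′ j′} → j < j′ → j′ < n → sw j ≡ just i → sw j′ ≡ just i′ → i′ < i ⊎ j ≤ i′
      uncrossed j<j′ j′<n sw≡ sw≡′
        with i , j , refl , refl , h ← hookAt (<-trans j<j′ j′<n) sw≡
        with i′ , j′ , refl , refl , h′ ← hookAt j′<n sw≡′
        with toℕ i′ <? toℕ i | toℕ j ≤? toℕ i′
      ... | yes i′<i | _ = inj₁ i′<i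
      ... | no _ | yes j≤i′ = inj₂ j≤i′
      ... | no i′≮i | no j≰i′ with m≤n⇒m<n∨m≡n (≮⇒≥ i′≮i)
      ...   | inj₁ i<i′ = contradiction (<⇒≤ (π-not-over h′ (≰⇒> j≰i′) j<j′))
              (no-crossing h h′ (λ { refl → n≮n _ j<j′ }) i<i′ (≰⇒> j≰i′))
      ...   | inj₂ eq with refl ← Fin.toℕ-injective eq
        with proj₁ (noCrossing i j i j′ h h′ (λ { refl → n≮n _ j<j′ }) i (lookup π j)
              (inj₂ (refl , ≤-refl , <⇒≤ (proj₁ (hooks i j h))))
              (inj₁ (refl , <⇒≤ (proj₂ (hooks i j h)) , <⇒≤ (π-not-over h′ (proj₁ (hooks i j h)) j<j′))))
      ...     | inj₁ eq′ = contradiction (proj₂ (hooks i j h)) (≤⇒≯ (≤-reflexive (cong (toℕ ∘ proj₂) eq′)))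
      ...     | inj₂ eq′ = contradiction (cong (toℕ ∘ proj₁) eq′) (<⇒≢ (proj₁ (hooks i j h)))

      covered : ∀ {p} → p < n →
        (∃[ j ] j < n × sw j ≡ just p) ⊎ (∃[ i ] sw p ≡ just i) ⊎ (∃[ o ] p ≡ suc o × val p < val o)
      covered p<n with p , refl ← fin p<n with reduced p
      ... | inj₁ (j , h)                    = inj₁ (toℕ j , Fin.toℕ<n j , hook⁺ h)
      ... | inj₂ (inj₁ (i , h))             = inj₂ (inj₁ (toℕ i , hook⁺ h))
      ... | inj₂ (inj₂ (o , o⋖p , desc))    = inj₂ (inj₂ (toℕ o , o⋖p , value⁺ desc))

    represents⇒surjective : ∀ {x} → x < n → ∃[ p ] p < n × val p ≡ x
    represents⇒surjective x<n with y , refl ← fin x<n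
      with i , eq ← injective⇒surjective (lookup π) perm y =
      toℕ i , Fin.toℕ<n i , trans (value i) (cong toℕ eq)

module _ {n val sw} {π : OneLine n} {H : HookSet n} (valid : Valid n val sw) (rep : Represents val sw π H) where

  open Valid valid
  open Represents rep

  private
    hook-rises : ∀ {i j} → (i , j) ∈ʰ H → i <ᶠ j × lookup π i <ᶠ lookup π j
    hook-rises {j = j} h = let i<j , up = rises (Fin.toℕ<n j) (hook⁺ h) in i<j , value⁻ up

    -- By `uncrossed` there are two cases. Either the hooks lie side by side and can share only the
    -- point at j, when i′ is j; or the first lies to the right of the vertical and below the
    -- horizontal segment of the second.
    nested-or-apart : ∀ {i j i′ j′} → (i , j) ∈ʰ H → (i′ , j′) ∈ʰ H → j <ᶠ j′ →
      MeetOnlyAtEndpoints π (i , j) (i′ , j′)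
    nested-or-apart {i} {j} {i′} {j′} h h′ j<j′ x y on on′
      with uncrossed j<j′ (Fin.toℕ<n j′) (hook⁺ h) (hook⁺ h′)
    ... | inj₂ j≤i′ = meet x≡j i′≡j on on′
      where
      i<j = proj₁ (hook-rises h)

      x≤j : x ≤ᶠ j
      x≤j = case on of λ { (inj₁ (refl , _)) → <⇒≤ i<j ; (inj₂ (_ , _ , x≤j)) → x≤j }

      i′≤x : i′ ≤ᶠ x
      i′≤x = case on′ of λ { (inj₁ (refl , _)) → ≤-refl ; (inj₂ (_ , i′≤x , _)) → i′≤x }

      x≡j : x ≡ j
      x≡j = Fin.toℕ-injective (≤-antisym x≤j (≤-trans j≤i′ i′≤x))

      i′≡j : i′ ≡ j
      i′≡j = Fin.toℕ-injective (≤-antisym (≤-trans i′≤x x≤j) j≤i′)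

      meet : x ≡ j → i′ ≡ j → OnHook π (i , j) (x , y) → OnHook π (i′ , j′) (x , y) →
        IsEndpoint π (i , j) (x , y) × IsEndpoint π (i′ , j′) (x , y)
      meet refl refl (inj₁ (refl , _)) _ = contradiction i<j (n≮n _)
      meet refl refl (inj₂ (refl , _)) _ = inj₂ refl , inj₁ refl
    ... | inj₁ i′<i with on | on′
    ...   | _ | inj₂ (refl , _) = contradiction
            (value⁻ (over (Fin.toℕ<n j′) (hook⁺ h′) (<-trans i′<i (proj₁ (hook-rises h))) j<j′))
            (≤⇒≯ (case on of λ { (inj₁ (_ , _ , y≤)) → y≤ ; (inj₂ (eq , _)) → ≤-reflexive (cong toℕ eq) }))
    ...   | inj₁ (refl , _) | inj₁ (refl , _)     = contradiction i′<i (n≮n _)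
    ...   | inj₂ (_ , i≤x , _) | inj₁ (refl , _)  = contradiction i′<i (≤⇒≯ i≤x)

    apart : ∀ i j i′ j′ → (i , j) ∈ʰ H → (i′ , j′) ∈ʰ H → (i , j) ≢ (i′ , j′) →
      MeetOnlyAtEndpoints π (i , j) (i′ , j′)
    apart i j i′ j′ h h′ distinct with <-cmp (toℕ j) (toℕ j′)
    ... | tri< j<j′ _ _ = nested-or-apart h h′ j<j′
    ... | tri> _ _ j′<j = λ x y on on′ → let e′ , e = nested-or-apart h′ h j′<j x y on′ on in e , e′
    ... | tri≈ _ eq _ with refl ← Fin.toℕ-injective eq
      with refl ← Fin.toℕ-injective (just-injective (trans (sym (hook⁺ h)) (hook⁺ h′))) = contradiction refl distinct

  valid⇒av312 : Av312 π
  valid⇒av312 =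
    (λ {i} {j} eq → Fin.toℕ-injective (injective (Fin.toℕ<n i) (Fin.toℕ<n j)
      (trans (value i) (trans (cong toℕ eq) (sym (value j))))))
    , λ a b c a<b b<c (b<c′ , c<a) → avoids a<b b<c (Fin.toℕ<n c) (value⁺ b<c′) (value⁺ c<a)

  valid⇒vhc : IsVHC π H
  valid⇒vhc = record
    { hooks = λ i j → hook-rises
    ; sw⇔top = λ i → mk⇔
      (λ (j , h) → case top (Fin.toℕ<n j) (hook⁺ h) of λ
        { (1+i<n , desc) → case fin 1+i<n of λ
          { (o , o≡) → o , o≡ , value⁻ (subst (λ x → val x < val (toℕ i)) (sym o≡) desc) } })
      (λ (o , i⋖o , desc) → case hooked (subst (_< n) i⋖o (Fin.toℕ<n o))
                                        (subst (λ x → val x < val (toℕ i)) i⋖o (value⁺ desc)) of λ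
        { (j , j<n , sw≡) → case fin j<n of λ { (j , refl) → j , hook⁻ sw≡ } })
    ; nothingOver = λ i j h (l , i<l , l<j , j<l) →
        <-asym j<l (value⁻ (over (Fin.toℕ<n j) (hook⁺ h) i<l l<j))
    ; noCrossing = apart }

  valid⇒reduced : IsReduced π H
  valid⇒reduced p with covered (Fin.toℕ<n p)
  ... | inj₁ (j , j<n , sw≡) with j , refl ← fin j<n = inj₁ (j , hook⁻ sw≡)
  valid⇒reduced p | inj₂ (inj₁ (i , sw≡)) with i , refl ← fin (sw< p sw≡) = inj₂ (inj₁ (i , hook⁻ sw≡))
  valid⇒reduced p | inj₂ (inj₂ (o , p≡ , desc)) with o , refl ← fin (<-trans (≤-reflexive (sym p≡)) (Fin.toℕ<n p)) =
    inj₂ (inj₂ (o , p≡ , value⁻ desc))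

module _ {n val sw} (valid : Valid n val sw) where

  open Valid valid

  private
    hook? = λ (i j : Fin n) → Maybe.≡-dec _≟_ (sw (toℕ j)) (just (toℕ i))

    permutation : OneLine n
    permutation = Vec.tabulate λ i → fromℕ< (bounded (Fin.toℕ<n i))

    hookRow : Fin n → Subset n
    hookRow i = Vec.tabulate (does ∘ hook? i)

    hookSet : HookSet n
    hookSet = Vec.tabulate hookRow

  realise : ∃[ π ] ∃[ H ] Represents {n} val sw π H
  realise = permutation , hookSet , record
    { value = λ i → sym (trans (cong toℕ (Vec.lookup∘tabulate _ i)) (Fin.toℕ-fromℕ< (bounded (Fin.toℕ<n i))))
    ; hook⁺ = λ {i} {j} h → ∈-tabulate-does⁻ (hook? i) (subst (j Subset.∈_) (Vec.lookup∘tabulate hookRow i) h)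
    ; hook⁻ = λ {i} {j} eq → subst (j Subset.∈_) (sym (Vec.lookup∘tabulate hookRow i)) (∈-tabulate-does⁺ (hook? i) eq)
    ; sw< = λ j sw≡ → <-trans (proj₁ (rises (Fin.toℕ<n j) sw≡)) (Fin.toℕ<n j) }

lookup-ext : ∀ {A : Set} {n} {u v : Vec A n} → (∀ i → lookup u i ≡ lookup v i) → u ≡ v
lookup-ext {u = u} {v} eq = trans (sym (Vec.tabulate∘lookup u)) (trans (Vec.tabulate-cong eq) (Vec.tabulate∘lookup v))

module _ {n : ℕ} {val val′ : ℕ → ℕ} {sw sw′ : ℕ → Maybe ℕ} where

  -- This carries two runs for one configuration over to the same functions, where `run-word` can
  -- compare their letters.
  represents-same : ∀ {π : OneLine n} {H} → Represents val sw π H → Represents val′ sw′ π H →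
    SameFrom 0 n val val′ sw sw′
  represents-same rep rep′ _ x<n with j , refl ← fin x<n =
    trans (R.value j) (sym (R′.value j)) , same-sw j
    where
    module R = Represents rep
    module R′ = Represents rep′

    same-sw : ∀ j → sw (toℕ j) ≡ sw′ (toℕ j)
    same-sw j with sw (toℕ j) in eq
    ... | just q with i , refl ← fin (R.sw< j eq) = sym (R′.hook⁺ (R.hook⁻ eq))
    same-sw j | nothing with sw′ (toℕ j) in eq′
    ... | nothing = refl
    ... | just q with i , refl ← fin (R′.sw< j eq′) = case trans (sym eq) (R.hook⁺ (R′.hook⁻ eq′)) of λ ()

  same-represents : ∀ {π π′ : OneLine n} {H H′} → SameFrom 0 n val val′ sw sw′ →
    Represents val sw π H → Represents val′ sw′ π′ H′ → (π , H) ≡ (π′ , H′)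
  same-represents same rep rep′ = cong₂ _,_
    (lookup-ext λ i → Fin.toℕ-injective
      (trans (sym (R.value i)) (trans (proj₁ (same z≤n (Fin.toℕ<n i))) (R′.value i))))
    (lookup-ext λ i → Subset.⊆-antisym
      (λ {j} h → R′.hook⁻ (trans (sym (proj₂ (same z≤n (Fin.toℕ<n j)))) (R.hook⁺ h)))
      (λ {j} h → R.hook⁻ (trans (proj₂ (same z≤n (Fin.toℕ<n j))) (R′.hook⁺ h))))
    where
    module R = Represents rep
    module R′ = Represents rep′

-- The bijection

zip-injective : ∀ {A B : Set} {m} {w w′ : Vec A m} {U U′ : Vec B m} →
  toList (zip w U) ≡ toList (zip w′ U′) → (w , U) ≡ (w′ , U′)
zip-injective {w = []} {[]} {[]} {[]} _ = refl
zip-injective {w = _ ∷ _} {_ ∷ _} {_ ∷ _} {_ ∷ _} eq with List.∷-injective eq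
... | refl , eq′ with refl ← zip-injective eq′ = refl

map-proj₁-zip : ∀ {A B : Set} {m} (w : Vec A m) (U : Vec B m) → map proj₁ (toList (zip w U)) ≡ toList w
map-proj₁-zip []      []      = refl
map-proj₁-zip (x ∷ w) (b ∷ U) = cong (x ∷_) (map-proj₁-zip w U)

-- The length is left open, since a decoded word is known to have length `3 * k` only once its
-- letters are counted.
unzipped : ∀ {A B : Set} (l : List (A × B)) → ∃[ m ] ∃[ w ] ∃[ U ] l ≡ toList (zip {n = m} w U)
unzipped []            = 0 , [] , [] , refl
unzipped ((x , b) ∷ l) with m , w , U , refl ← unzipped l = suc m , x ∷ w , b ∷ U , refl

-- `val` and `sw` are hidden because the configuration fixes them only below `n`.
Encodes : ∀ k {n} → Word k × Subset (3 * k) → Configuration n → Set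
Encodes k {n} (w , U) (π , H) = ∃[ val ] ∃[ sw ]
  Represents val sw π H × Run n val sw 0 0 [] [] pushed (toList (zip w U))

module _ {k n : ℕ} where

  encodes-functional : ∀ {a} {c c′ : Configuration n} → Encodes k a c → Encodes k a c′ → c ≡ c′
  encodes-functional (_ , _ , rep , run) (_ , _ , rep′ , run′) = same-represents (run-same run run′) rep rep′

  encodes-injective : ∀ {a a′} {c : Configuration n} → Encodes k a c → Encodes k a′ c → a ≡ a′
  encodes-injective {w , U} {w′ , U′} (_ , _ , rep , run) (_ , _ , rep′ , run′) =
    zip-injective (run-word [] (run-cong (represents-same rep rep′) run) run′)

length≡ : ∀ {k m} (w : Vec Letter m) → occurrences X (toList w) ≡ occurrences Y (toList w) →
  occurrences Y (toList w) ≡ occurrences Z (toList w) → occurrences Z (toList w) ≡ k → m ≡ 3 * k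
length≡ {k} {m} w X≡Y Y≡Z Z≡k = begin
  m
    ≡⟨ occurrences-total w ⟨
  occurrences X (toList w) + occurrences Y (toList w) + occurrences Z (toList w)
    ≡⟨ cong₂ _+_ (cong₂ _+_ (trans X≡Y (trans Y≡Z Z≡k)) (trans Y≡Z Z≡k)) Z≡k ⟩
  k + k + k
    ≡⟨ +-assoc k k k ⟩
  k + (k + k)
    ≡⟨ cong (λ x → k + (k + x)) (+-identityʳ k) ⟨
  3 * k ∎
  where open ≡-Reasoning

module _ {k i : ℕ} where

  encode : ∀ a → IsUnderlinedDuck k i a →
    ∃[ c ] RedVHC {3 * k ∸ i} k Av312 c × Encodes k a c
  encode (w , U) duck
    with val , sw , run ← path⇒run {v = 0} {S = []} {[]} after-X (start-after-X (duck⇒path {k} {i} {w} {U} duck)) refl refl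
           (trans (sym (m+n∸n≡m _ i)) (cong (_∸ i) (duck⇒points {k} {i} {w} {U} duck)))
    with π , H , rep ← realise (run⇒valid run) =
    (π , H) , (valid⇒av312 valid rep , valid⇒vhc valid rep , valid⇒reduced valid rep , count) , val , sw , rep , run
    where
    valid = run⇒valid run
    count = trans (hookCount≡occurrences rep run)
      (trans (cong (occurrences Z) (map-proj₁-zip w U)) (proj₁ (proj₁ duck) Z))

  decode : i ≤ 3 * k → ∀ c → RedVHC {3 * k ∸ i} k Av312 c →
    ∃[ a ] IsUnderlinedDuck k i a × Encodes k a c
  decode i≤3k (π , H) ((perm , avoids) , vhc , reduced , count)
    with val , sw , rep ← represent perm vhc
    with l , run ← valid⇒run (represents⇒valid perm vhc avoids reduced rep) (represents⇒surjective perm vhc avoids reduced rep)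
    with m , w , U , refl ← unzipped l
    with path ← run⇒path {ℓ = Y} (λ ()) (λ ()) run
    with _ , (X≡Y , Y≡Z) , _ ← path⇒word w U path
    -- There are as many Z's as hooks, and balance then fixes the length of the word.
    with refl ← length≡ w X≡Y Y≡Z (trans (sym (trans (hookCount≡occurrences rep run) (cong (occurrences Z) (map-proj₁-zip w U)))) count) =
    (w , U) , path⇒duck {k} {i} {w} {U} path
      (trans (sym (trans (hookCount≡occurrences rep run) (cong (occurrences Z) (map-proj₁-zip w U)))) count)
      (trans (cong (_+ i) (run-points (λ ()) run)) (m∸n+n≡m i≤3k))
    , val , sw , rep , run

-- The bound on `i` keeps the truncated subtraction exact, as decoding has to recover `3 * k` from
-- the number of points.
∣RedVHC∣≡UnderlinedDuck : ∀ k i → i ≤ 3 * k → ∣RedVHC∣ k (av312? {3 * k ∸ i}) ≡ UnderlinedDuck k i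
∣RedVHC∣≡UnderlinedDuck k i i≤3k = ≤-antisym
  (card-≤ (configurations _) ducks (redVHC? k av312?) (isUnderlinedDuck? k i) (λ c a → Encodes k a c)
    (decode i≤3k) (encodes-functional {k}))
  (card-≤ ducks (configurations _) (isUnderlinedDuck? k i) (redVHC? k av312?) (Encodes k)
    (encode {k} {i}) (encodes-injective {k}))
  where ducks = words k ⊗ subsets (3 * k)

theorem5p1 : ∀ (k i : ℕ) → 1 ≤ k → i ≤ k ∸ 1 →
    ∣RedVHC∣ k (av312? {3 * k ∸ i}) ≡ UnderlinedDuck k i
    × UnderlinedDuck k i ≡ ∑[ i ≤j< k ] (λ j → (j C i) * Duck k j)
theorem5p1 k i 1≤k i≤k-1 =
  ∣RedVHC∣≡UnderlinedDuck k i (≤-trans i≤k-1 (≤-trans (m∸n≤m k 1) (m≤m+n k _))) ,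
  UnderlinedDuck≡∑Duck k i (card-bareY< 1≤k)
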